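{- For $d\ge 1$ let $S_d$ be the maximal cardinality of a neighborly family of $d$-dimensional simplices in $\mathbb{R}^d$. Then $$\lim_{d\rightarrow\infty}\left(2^{d+1}-S_d\right)=\infty .$$
   Context: Two $d$-dimensional simplices in $\mathbb{R}^d$ are called neighborly if their intersection is a $(d-1)$-dimensional set. A family of $d$-dimensional simplices in $\mathbb{R}^d$ is called neighborly if every two (distinct) simplices of the family are neighborly. (It is known that such families have at most $2^{d+1}$ members, so $S_d$ is a well-defined integer.) -}

module Defs where

open import Algebra.Apartness.Bundles using (HeytingCommutativeRing; HeytingField)
open import Algebra.Bundles using (CommutativeRing)
open import Data.Fin.Base using (Fin)
open import Data.Integer.Base as ℤ using (ℤ)
open import Data.Nat.Base as ℕ using (ℕ; suc)
open import Data.Product.Base using (_×_; ∃-syntax)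
open import Data.Sum.Base using (_⊎_)
open import Data.Vec.Functional using (Vector)
open import Function.Bundles using (_⇔_)
open import Level using (Level; _⊔_) renaming (suc to lsuc)
open import Relation.Binary.Core using (Rel)
open import Relation.Binary.PropositionalEquality.Core using (_≢_)
open import Relation.Binary.Structures using (IsStrictPartialOrder)
open import Relation.Nullary.Negation using (¬_)
open import Relation.Unary using (Pred; _∩_; _≐_)

import Algebra.Definitions.RawMonoid as RawMonoidDefinitions
import Data.Vec.Functional.Relation.Binary.Equality.Setoid as VectorEquality

-- The real numbers, by the constructive axioms of Geuvers and Niqui: an
-- Archimedean, Cauchy complete ordered field.  These axioms determine the
-- field up to isomorphism, and both the classical ℝ and the setoid of Cauchy
-- sequences of rationals satisfy them.  0 ≉ 1 follows from invertible⇒#.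
record RealNumbers c ℓ₁ ℓ₂ : Set (lsuc (c ⊔ ℓ₁ ⊔ ℓ₂)) where
  infix 4 _<_ _≤_
  field
    heytingField : HeytingField c ℓ₁ ℓ₂

  open HeytingField heytingField public

  field
    _<_                  : Rel Carrier ℓ₂
    isStrictPartialOrder : IsStrictPartialOrder _≈_ _<_
    #⇔<⊎>                : ∀ {x y} → (x # y) ⇔ (x < y ⊎ y < x)
    +-monoˡ-<            : ∀ {x y} z → x < y → x + z < y + z
    *-pos                : ∀ {x y} → 0# < x → 0# < y → 0# < x * y

  ring : CommutativeRing c ℓ₁
  ring = HeytingCommutativeRing.commutativeRing heytingCommutativeRing

  open RawMonoidDefinitions (CommutativeRing.+-rawMonoid ring) public
    using (sum) renaming (_×_ to _·_)

  _≤_ : Rel Carrier ℓ₂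
  x ≤ y = ¬ (y < x)

  IsCauchy : (ℕ → Carrier) → Set (c ⊔ ℓ₂)
  IsCauchy s = ∀ ε → 0# < ε →
    ∃[ N ] (∀ m n → N ℕ.≤ m → N ℕ.≤ n → s m - s n < ε)

  _ConvergesTo_ : (ℕ → Carrier) → Carrier → Set (c ⊔ ℓ₂)
  s ConvergesTo x = ∀ ε → 0# < ε →
    ∃[ N ] (∀ n → N ℕ.≤ n → (s n - x < ε) × (x - s n < ε))

  field
    archimedean : ∀ x → ∃[ n ] (x < n · 1#)
    complete    : ∀ s → IsCauchy s → ∃[ x ] (s ConvergesTo x)

module Simplices {c ℓ₁ ℓ₂ : Level} (R : RealNumbers c ℓ₁ ℓ₂) where

  open RealNumbers R using (Carrier; _≈_; _≤_; _*_; 0#; 1#; ring; sum)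
  open VectorEquality (CommutativeRing.setoid ring) using (_≋_)

  Point : ℕ → Set c
  Point d = Vector Carrier d

  combination : ∀ {d m} → Vector Carrier m → Vector (Point d) m → Point d
  combination w p j = sum (λ i → w i * p i j)

  AffinelyIndependent : ∀ {d m} → Vector (Point d) m → Set (c ⊔ ℓ₁)
  AffinelyIndependent p = ∀ w → sum w ≈ 0# →
    combination w p ≋ (λ _ → 0#) → ∀ i → w i ≈ 0#

  affineSpan : ∀ {d m} → Vector (Point d) m → Pred (Point d) (c ⊔ ℓ₁)
  affineSpan p x = ∃[ w ] (sum w ≈ 1# × combination w p ≋ x)

  convexHull : ∀ {d m} → Vector (Point d) m → Pred (Point d) (c ⊔ ℓ₁ ⊔ ℓ₂)
  convexHull p x = ∃[ w ] ((∀ i → 0# ≤ w i) × sum w ≈ 1# × combination w p ≋ x)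

  affineHull : ∀ {d ℓ} → Pred (Point d) ℓ → Pred (Point d) (c ⊔ ℓ₁ ⊔ ℓ)
  affineHull {d} A x =
    ∃[ m ] ∃[ p ] ((∀ (i : Fin m) → A (p i)) × affineSpan {d} {m} p x)

  -- The dimension of a set is that of its affine hull.
  HasDimension : ∀ {d ℓ} → Pred (Point d) ℓ → ℕ → Set (c ⊔ ℓ₁ ⊔ ℓ)
  HasDimension {d} A k =
    ∃[ p ] (AffinelyIndependent {d} {suc k} p × affineHull A ≐ affineSpan p)

  record Simplex (d : ℕ) : Set (c ⊔ ℓ₁) where
    field
      vertices    : Vector (Point d) (suc d)
      independent : AffinelyIndependent vertices

  ⟦_⟧ : ∀ {d} → Simplex d → Pred (Point d) (c ⊔ ℓ₁ ⊔ ℓ₂)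
  ⟦ σ ⟧ = convexHull (Simplex.vertices σ)

  -- Only meaningful for d ≥ 1, because of the truncated subtraction.
  Neighborly : ∀ {d} → Simplex d → Simplex d → Set (c ⊔ ℓ₁ ⊔ ℓ₂)
  Neighborly {d} σ τ = HasDimension (⟦ σ ⟧ ∩ ⟦ τ ⟧) (d ℕ.∸ 1)

  -- A family of cardinality n is enumerated without repetition; simplices are
  -- compared as sets of points, not as tuples of vertices.
  record IsNeighborlyFamily {d n} (F : Fin n → Simplex d) : Set (c ⊔ ℓ₁ ⊔ ℓ₂) where
    field
      distinct   : ∀ {i j} → i ≢ j → ¬ (⟦ F i ⟧ ≐ ⟦ F j ⟧)
      neighborly : ∀ {i j} → i ≢ j → Neighborly (F i) (F j)

  record IsMaximalCardinality (d s : ℕ) : Set (c ⊔ ℓ₁ ⊔ ℓ₂) where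
    field
      attained : ∃[ F ] IsNeighborlyFamily {d} {s} F
      maximal  : ∀ {n} (F : Fin n → Simplex d) → IsNeighborlyFamily F → n ℕ.≤ s

TendsToInfinity : (ℕ → ℤ) → Set
TendsToInfinity f = ∀ (K : ℤ) → ∃[ N ] (∀ d → N ℕ.≤ d → K ℤ.≤ f d)

{-# OPTIONS --safe #-}
module Submission where

-- A d-dimensional simplex is a system of w = d + 1 sign conditions on the
-- hyperplanes of its facets, hence a subcube of codimension w in the cube of
-- all sign vectors on the hyperplanes occurring in a family of n simplices.
-- Two neighborly simplices lie on opposite sides of a common facet hyperplane,
-- so these subcubes are disjoint.  Fix one simplex σ of the family and let F s
-- be 2 ^ w times the proportion of sign vectors lying in no subcube, among
-- those that restrict to s on the facets of σ.  Then F ≥ 0, F has integer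
-- Fourier coefficients and mean 2 ^ w - n, and F vanishes at the sign vector of
-- σ, taken as the origin.  Unless such a function is identically zero, some
-- character sum of it is negative, and restricting to the hyperplane orthogonal
-- to that character lowers the mean, which remains an integer; hence F vanishes
-- on a subspace of codimension at most 2 ^ w - n.  On the other hand F s > 0
-- for every s of mixed signs, since such an s is realized by a generic
-- direction and points far away in that direction lie in no simplex.  Therefore
-- n + d ≤ 2 ^ w.  Finitely many case distinctions on real numbers are made
-- under a double negation, which is harmless because the bound is decidable.

open import Data.Bool.Base using (Bool; true; false; not; _∧_; _xor_)
import Data.Bool.Properties as Bool
open import Data.Fin.Base as Fin using (Fin; zero; suc; punchIn; combine; remQuot; splitAt; toℕ; _↑ˡ_; _↑ʳ_)
import Data.Fin.Properties as Fin
import Data.Integer.Base as ℤ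
import Data.Integer.Properties as ℤ
open import Data.List.Base as List using (List; []; _∷_)
import Data.List.Properties as List
open import Data.List.Relation.Unary.All as All using (All; []; _∷_)
import Data.List.Relation.Unary.All.Properties as All
open import Data.List.Relation.Unary.AllPairs using (AllPairs; []; _∷_)
import Data.List.Relation.Unary.AllPairs.Properties as AllPairs
open import Data.Maybe.Base using (Maybe; just; nothing)
open import Data.Nat.Base as ℕ using (ℕ; zero; suc; z≤n; s≤s)
import Data.Nat.Properties as ℕ
open import Data.Product.Base using (_×_; _,_; proj₁; proj₂; ∃-syntax; Σ-syntax; uncurry)
open import Data.Sum.Base using (_⊎_; inj₁; inj₂; [_,_]′)
open import Data.Vec.Base as Vec using (Vec; []; _∷_; _++_; replicate; lookup; tabulate)
import Data.Vec.Properties as Vec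
open import Function.Base using (_∘_; case_of_)
open import Level using (Level; _⊔_)
open import Relation.Binary.PropositionalEquality as ≡ using (_≡_; _≢_)
open import Relation.Nullary using (¬_; Dec; yes; no; contradiction)
open import Relation.Nullary.Decidable using (¬¬-excluded-middle; decidable-stable)

open import Defs using (RealNumbers; module Simplices; TendsToInfinity)

-- Fourier analysis on the Boolean cube.

module Cube where

  open import Data.Integer.Base using (ℤ; +_; 0ℤ; 1ℤ; -1ℤ; +≤+; +<+; _+_; _*_; -_; _≤_; _<_; _^_)
  open import Data.Integer.Tactic.RingSolver using (solve-∀)
  open import Data.Vec.Properties using (∷-injectiveˡ; ∷-injectiveʳ)
  open import Relation.Binary.PropositionalEquality

  private
    variable
      m n w : ℕ
      F G : Vec Bool w → ℤ

  2^_ : ℕ → ℤ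
  2^ n = (+ 2) ^ n

  2^-pos : ∀ n → 0ℤ < 2^ n
  2^-pos zero    = +<+ (s≤s z≤n)
  2^-pos (suc n) = ℤ.*-monoˡ-<-pos (+ 2) (2^-pos n)

  2^-+ : ∀ n → 2^ n ≡ + (2 ℕ.^ n)
  2^-+ zero    = refl
  2^-+ (suc n) = trans (cong (+ 2 *_) (2^-+ n)) (sym (ℤ.pos-* 2 (2 ℕ.^ n)))

  2^-nonNeg : ∀ n → 0ℤ ≤ 2^ n
  2^-nonNeg n = ℤ.<⇒≤ (2^-pos n)

  +-nonNeg : ∀ {i j} → 0ℤ ≤ i → 0ℤ ≤ j → 0ℤ ≤ i + j
  +-nonNeg = ℤ.+-mono-≤

  nonNeg-sum≤0 : ∀ {i j} → 0ℤ ≤ i → 0ℤ ≤ j → i + j ≤ 0ℤ → i ≤ 0ℤ × j ≤ 0ℤ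
  nonNeg-sum≤0 {i} {j} i≥0 j≥0 i+j≤0 =
    ℤ.≤-trans (subst (_≤ i + j) (ℤ.+-identityʳ i) (ℤ.+-monoʳ-≤ i j≥0)) i+j≤0 ,
    ℤ.≤-trans (subst (_≤ i + j) (ℤ.+-identityˡ j) (ℤ.+-monoˡ-≤ j i≥0)) i+j≤0

  *-cancelˡ-≤-2^ : ∀ n {i j} → 2^ n * i ≤ 2^ n * j → i ≤ j
  *-cancelˡ-≤-2^ n {i} {j} = ℤ.*-cancelˡ-≤-pos i j (2^ n) {{ℤ.positive (2^-pos n)}}

  *-cancelˡ-<-2^ : ∀ n {i j} → 2^ n * i < 2^ n * j → i < j
  *-cancelˡ-<-2^ n = ℤ.*-cancelˡ-<-nonNeg (2^ n) {{ℤ.nonNegative (2^-nonNeg n)}}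

  -- Sums over the cube

  cubeSum : (Vec Bool w → ℤ) → ℤ
  cubeSum {zero}  F = F []
  cubeSum {suc w} F = cubeSum (F ∘ (false ∷_)) + cubeSum (F ∘ (true ∷_))

  cubeSum-cong : F ≗ G → cubeSum F ≡ cubeSum G
  cubeSum-cong {zero}  F≗G = F≗G []
  cubeSum-cong {suc w} F≗G =
    cong₂ _+_ (cubeSum-cong (F≗G ∘ (false ∷_))) (cubeSum-cong (F≗G ∘ (true ∷_)))

  cubeSum-+ : (F G : Vec Bool w → ℤ) → cubeSum (λ s → F s + G s) ≡ cubeSum F + cubeSum G
  cubeSum-+ {zero}  F G = refl
  cubeSum-+ {suc w} F G = trans
    (cong₂ _+_ (cubeSum-+ (F ∘ (false ∷_)) _) (cubeSum-+ (F ∘ (true ∷_)) _))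
    (interchange (cubeSum (F ∘ (false ∷_))) _ _ _)
    where
    interchange : ∀ a b c d → (a + b) + (c + d) ≡ (a + c) + (b + d)
    interchange = solve-∀

  cubeSum-* : ∀ c (F : Vec Bool w → ℤ) → cubeSum (λ s → c * F s) ≡ c * cubeSum F
  cubeSum-* {zero}  c F = refl
  cubeSum-* {suc w} c F = trans
    (cong₂ _+_ (cubeSum-* c (F ∘ (false ∷_))) (cubeSum-* c (F ∘ (true ∷_))))
    (sym (ℤ.*-distribˡ-+ c (cubeSum (F ∘ (false ∷_))) _))

  cubeSum-neg : (F : Vec Bool w → ℤ) → cubeSum (λ s → - F s) ≡ - cubeSum F
  cubeSum-neg F = trans (cubeSum-cong λ s → sym (ℤ.-1*i≡-i (F s)))
    (trans (cubeSum-* -1ℤ F) (ℤ.-1*i≡-i _))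

  cubeSum-const : ∀ w c → cubeSum {w} (λ _ → c) ≡ 2^ w * c
  cubeSum-const zero    c = sym (ℤ.*-identityˡ c)
  cubeSum-const (suc w) c = trans (cong₂ _+_ (cubeSum-const w c) (cubeSum-const w c))
    (double (2^ w) c)
    where
    double : ∀ x c → x * c + x * c ≡ + 2 * x * c
    double = solve-∀

  cubeSum-nonNeg : (∀ s → 0ℤ ≤ F s) → 0ℤ ≤ cubeSum F
  cubeSum-nonNeg {zero}  F≥0 = F≥0 []
  cubeSum-nonNeg {suc w} F≥0 =
    +-nonNeg (cubeSum-nonNeg (F≥0 ∘ (false ∷_))) (cubeSum-nonNeg (F≥0 ∘ (true ∷_)))

  cubeSum≤0⇒≤0 : (∀ s → 0ℤ ≤ F s) → cubeSum F ≤ 0ℤ → ∀ s → F s ≤ 0ℤ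
  cubeSum≤0⇒≤0 {zero}  F≥0 ∑F≤0 [] = ∑F≤0
  cubeSum≤0⇒≤0 {suc w} F≥0 ∑F≤0 (b ∷ s)
    with nonNeg-sum≤0 (cubeSum-nonNeg (F≥0 ∘ (false ∷_))) (cubeSum-nonNeg (F≥0 ∘ (true ∷_))) ∑F≤0 | b
  ... | left , _  | false = cubeSum≤0⇒≤0 (F≥0 ∘ (false ∷_)) left s
  ... | _ , right | true  = cubeSum≤0⇒≤0 (F≥0 ∘ (true ∷_)) right s

  cubeSum<0⇒∃<0 : (F : Vec Bool w → ℤ) → cubeSum F < 0ℤ → ∃[ s ] F s < 0ℤ
  cubeSum<0⇒∃<0 {zero}  F ∑F<0 = [] , ∑F<0
  cubeSum<0⇒∃<0 {suc w} F ∑F<0 with cubeSum (F ∘ (false ∷_)) ℤ.<? 0ℤ | cubeSum (F ∘ (true ∷_)) ℤ.<? 0ℤ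
  ... | yes p | _     = let s , q = cubeSum<0⇒∃<0 _ p in false ∷ s , q
  ... | no _  | yes p = let s , q = cubeSum<0⇒∃<0 _ p in true ∷ s , q
  ... | no ¬p | no ¬q = contradiction ∑F<0
    (ℤ.≤⇒≯ (+-nonNeg (ℤ.≮⇒≥ ¬p) (ℤ.≮⇒≥ ¬q)))

  -- The additive group of the cube

  -- Nonvanishing as data: a proof records the position of the first `true`, the coordinate that
  -- `hyperplane` solves for.
  data Nonzero : Vec Bool w → Set where
    here  : ∀ {S : Vec Bool w} → Nonzero (true ∷ S)
    there : ∀ {S : Vec Bool w} → Nonzero S → Nonzero (false ∷ S)

  origin : Vec Bool w
  origin = replicate _ false

  ≢origin⇒Nonzero : (S : Vec Bool w) → S ≢ origin → Nonzero S
  ≢origin⇒Nonzero []          S≢0 = contradiction refl S≢0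
  ≢origin⇒Nonzero (true ∷ S)  S≢0 = here
  ≢origin⇒Nonzero (false ∷ S) S≢0 = there (≢origin⇒Nonzero S (S≢0 ∘ cong (false ∷_)))

  -- The values off the origin have a negative sum. If the half with first coordinate `true` has a
  -- nonnegative sum, the half containing the origin inherits both hypotheses.
  negativeAwayFromOrigin : (F : Vec Bool w → ℤ) → cubeSum F ≤ 0ℤ → 0ℤ < F origin →
    ∃[ S ] (Nonzero S × F S < 0ℤ)
  negativeAwayFromOrigin {zero}  F ∑F≤0 F0>0 = contradiction F0>0 (ℤ.≤⇒≯ ∑F≤0)
  negativeAwayFromOrigin {suc w} F ∑F≤0 F0>0 with cubeSum (F ∘ (true ∷_)) ℤ.<? 0ℤ
  ... | yes p = let s , q = cubeSum<0⇒∃<0 _ p in true ∷ s , here , q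
  ... | no ¬p =
    let S , nz , q = negativeAwayFromOrigin (F ∘ (false ∷_))
          (ℤ.≤-trans (subst (_≤ ∑₀ + ∑₁) (ℤ.+-identityʳ ∑₀) (ℤ.+-monoʳ-≤ ∑₀ (ℤ.≮⇒≥ ¬p))) ∑F≤0) F0>0
    in false ∷ S , there nz , q
    where
    ∑₀ = cubeSum (F ∘ (false ∷_))
    ∑₁ = cubeSum (F ∘ (true ∷_))

  dot : Vec Bool w → Vec Bool w → Bool
  dot []      []      = false
  dot (a ∷ S) (b ∷ s) = (a ∧ b) xor dot S s

  dot-originˡ : (s : Vec Bool w) → dot origin s ≡ false
  dot-originˡ []      = refl
  dot-originˡ (b ∷ s) = dot-originˡ s

  dot-originʳ : (S : Vec Bool w) → dot S origin ≡ false
  dot-originʳ []          = refl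
  dot-originʳ (false ∷ S) = dot-originʳ S
  dot-originʳ (true ∷ S)  = dot-originʳ S

  dot-xor : (S T s : Vec Bool w) → dot (Vec.zipWith _xor_ S T) s ≡ dot S s xor dot T s
  dot-xor []      []      []      = refl
  dot-xor (a ∷ S) (b ∷ T) (c ∷ s) =
    trans (cong (((a xor b) ∧ c) xor_) (dot-xor S T s)) (distrib a b c (dot S s) (dot T s))
    where
    distrib : ∀ a b c x y → ((a xor b) ∧ c) xor (x xor y) ≡ ((a ∧ c) xor x) xor ((b ∧ c) xor y)
    distrib false false c x y = refl
    distrib false true false x y = refl
    distrib false true true false y = refl
    distrib false true true true false = refl
    distrib false true true true true = refl
    distrib true false false x y = refl
    distrib true false true false y = refl
    distrib true false true true false = refl
    distrib true false true true true = refl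
    distrib true true false x y = refl
    distrib true true true false false = refl
    distrib true true true false true = refl
    distrib true true true true false = refl
    distrib true true true true true = refl

  sign : Bool → ℤ
  sign false = 1ℤ
  sign true  = -1ℤ

  character : Vec Bool w → Vec Bool w → ℤ
  character S s = sign (dot S s)

  sign-true-xor : ∀ b → sign (true xor b) ≡ - sign b
  sign-true-xor false = refl
  sign-true-xor true  = refl

  -- The trivial character sums to 2 ^ w; for any other the two halves at the first `true` cancel.
  -- Only divisibility by 2 ^ w is kept.
  cubeSum-character : (S : Vec Bool w) → ∃[ c ] cubeSum (character S) ≡ 2^ w * c
  cubeSum-character []                = 1ℤ , refl
  cubeSum-character {suc w} (false ∷ S) = let c , eq = cubeSum-character S in
    c , trans (cong₂ _+_ eq eq) (double (2^ w) c)
    where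
    double : ∀ x c → x * c + x * c ≡ + 2 * x * c
    double = solve-∀
  cubeSum-character {suc w} (true ∷ S)  = 0ℤ , trans
    (cong (λ z → ∑S + z) (trans (cubeSum-cong (sign-true-xor ∘ dot S)) (cubeSum-neg (character S))))
    (trans (ℤ.+-inverseʳ ∑S) (sym (ℤ.*-zeroʳ (2^ suc w))))
    where ∑S = cubeSum (character S)

  -- With A and B the double sums for `F₀` and `F₁`, the two values of the first entry of S
  -- contribute A + B and A - B. Their sum is 2 A, so only the half containing the origin survives.
  fourierInversion : (F : Vec Bool w → ℤ) →
    cubeSum (λ S → cubeSum (λ s → F s * character S s)) ≡ 2^ w * F origin
  fourierInversion {zero}  F = ℤ.*-comm (F []) 1ℤ
  fourierInversion {suc w} F =
    trans (cong₂ _+_ (cubeSum-+ {w} (λ S → cubeSum (λ s → F₀ s * character S s)) _)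
      (trans (cubeSum-cong {w} λ S → cong (λ z → cubeSum (λ s → F₀ s * character S s) + z) (flip S))
         (cubeSum-+ {w} (λ S → cubeSum (λ s → F₀ s * character S s)) _)))
    (trans (cong (λ z → (A + B) + (A + z)) (cubeSum-neg {w} (λ S → cubeSum (λ s → F₁ s * character S s))))
    (trans (cancel A B) (trans (cong (+ 2 *_) (fourierInversion F₀)) (sym (ℤ.*-assoc (+ 2) (2^ w) _)))))
    where
    F₀ = F ∘ (false ∷_)
    F₁ = F ∘ (true ∷_)
    A = cubeSum (λ S → cubeSum (λ s → F₀ s * character S s))
    B = cubeSum (λ S → cubeSum (λ s → F₁ s * character S s))
    flip : ∀ S → cubeSum (λ s → F₁ s * sign (true xor dot S s)) ≡ - cubeSum (λ s → F₁ s * character S s)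
    flip S = trans (cubeSum-cong λ s → trans (cong (F₁ s *_) (sign-true-xor (dot S s)))
      (sym (ℤ.neg-distribʳ-* (F₁ s) _))) (cubeSum-neg (λ s → F₁ s * character S s))
    cancel : ∀ a b → (a + b) + (a + - b) ≡ + 2 * a
    cancel = solve-∀

  -- Parametrization of the hyperplane of the s with dot S s ≡ false.
  hyperplane : ∀ {S : Vec Bool (suc w)} → Nonzero S → Vec Bool w → Vec Bool (suc w)
  hyperplane (here {S = S}) s = dot S s ∷ s
  hyperplane {w = suc w} (there nz) (b ∷ s) = b ∷ hyperplane nz s

  hyperplane-injective : ∀ {S : Vec Bool (suc w)} (nz : Nonzero S) {s t} →
    hyperplane nz s ≡ hyperplane nz t → s ≡ t
  hyperplane-injective here eq = ∷-injectiveʳ eq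
  hyperplane-injective {w = suc w} (there nz) {b ∷ s} {c ∷ t} eq =
    cong₂ _∷_ (∷-injectiveˡ eq) (hyperplane-injective nz (∷-injectiveʳ eq))

  hyperplane-origin : ∀ {S : Vec Bool (suc w)} (nz : Nonzero S) → hyperplane nz origin ≡ origin
  hyperplane-origin (here {S = S}) = cong (_∷ origin) (dot-originʳ S)
  hyperplane-origin {w = suc w} (there nz) = cong (false ∷_) (hyperplane-origin nz)

  -- The factor 1 + `character S` is 2 on the hyperplane and 0 off it.
  cubeSum-hyperplane : ∀ {S : Vec Bool (suc w)} (nz : Nonzero S) (F : Vec Bool (suc w) → ℤ) →
    + 2 * cubeSum (F ∘ hyperplane nz) ≡ cubeSum F + cubeSum (λ s → F s * character S s)
  cubeSum-hyperplane {w} (here {S = S}) F =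
    trans (sym (cubeSum-* (+ 2) (F ∘ hyperplane (here {S = S}))))
    (trans (cubeSum-cong pointwise)
    (trans (cubeSum-+ {w} (λ s → F₀ s + F₁ s) _)
    (cong₂ _+_ (cubeSum-+ F₀ F₁) (cubeSum-+ {w} (λ s → F₀ s * character S s) _))))
    where
    F₀ = F ∘ (false ∷_)
    F₁ = F ∘ (true ∷_)
    evenPart : ∀ x y → + 2 * x ≡ (x + y) + (x * 1ℤ + y * -1ℤ)
    evenPart = solve-∀
    oddPart : ∀ x y → + 2 * y ≡ (x + y) + (x * -1ℤ + y * 1ℤ)
    oddPart = solve-∀
    pointwise : ∀ s → + 2 * F (dot S s ∷ s) ≡
      (F₀ s + F₁ s) + (F₀ s * character S s + F₁ s * sign (true xor dot S s))
    pointwise s with dot S s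
    ... | false = evenPart (F₀ s) (F₁ s)
    ... | true  = oddPart (F₀ s) (F₁ s)
  cubeSum-hyperplane {suc w} (there {S = S} nz) F =
    trans (ℤ.*-distribˡ-+ (+ 2) (cubeSum (F₀ ∘ hyperplane nz)) _)
    (trans (cong₂ _+_ (cubeSum-hyperplane nz F₀) (cubeSum-hyperplane nz F₁))
    (interchange (cubeSum F₀) _ _ _))
    where
    F₀ = F ∘ (false ∷_)
    F₁ = F ∘ (true ∷_)
    interchange : ∀ a b c d → (a + b) + (c + d) ≡ (a + c) + (b + d)
    interchange = solve-∀

  -- The transpose of `hyperplane`: the solved coordinate equals `dot S s`, so its coefficient `a`
  -- is redistributed over the other coordinates as a multiple of `S`.
  pullback : ∀ {S : Vec Bool (suc w)} → Nonzero S → Vec Bool (suc w) → Vec Bool w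
  pullback (here {S = S}) (a ∷ A) = Vec.zipWith _xor_ (Vec.map (a ∧_) S) A
  pullback {w = suc w} (there nz) (a ∷ A) = a ∷ pullback nz A

  dot-hyperplane : ∀ {S : Vec Bool (suc w)} (nz : Nonzero S) A s →
    dot A (hyperplane nz s) ≡ dot (pullback nz A) s
  dot-hyperplane (here {S = S}) (a ∷ A) s =
    sym (trans (dot-xor (Vec.map (a ∧_) S) A s) (cong (_xor dot A s) (scale a S s)))
    where
    scale : ∀ {w} a (S s : Vec Bool w) → dot (Vec.map (a ∧_) S) s ≡ a ∧ dot S s
    scale true  []      []      = refl
    scale false []      []      = refl
    scale true  (b ∷ S) (c ∷ s) = cong ((b ∧ c) xor_) (scale true S s)
    scale false (b ∷ S) (c ∷ s) = scale false S s
  dot-hyperplane {w = suc w} (there nz) (a ∷ A) (b ∷ s) = cong ((a ∧ b) xor_) (dot-hyperplane nz A s)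

  -- Functions with integer Fourier coefficients

  -- The integer span of the characters, generated inductively so that restriction to a hyperplane
  -- and integrality of the mean are recursions. Each constructor carries a pointwise equation
  -- because functions are only compared pointwise.
  data Integral {w} (F : Vec Bool w → ℤ) : Set where
    char : ∀ A → F ≗ character A → Integral F
    plus : ∀ {G H} → Integral G → Integral H → F ≗ (λ s → G s + H s) → Integral F
    neg  : ∀ {G} → Integral G → F ≗ (λ s → - G s) → Integral F

  -- The quotient `c` is the coefficient of the trivial character, since all other characters sum to
  -- zero.
  Integral-mean : ∀ {F : Vec Bool w → ℤ} → Integral F → ∃[ c ] cubeSum F ≡ 2^ w * c
  Integral-mean (char A eq)           = let c , p = cubeSum-character A in c , trans (cubeSum-cong eq) p
  Integral-mean {w} (plus {G} {H} g h eq) =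
    let c , p = Integral-mean g
        d , q = Integral-mean h
    in c + d , trans (cubeSum-cong eq) (trans (cubeSum-+ G H)
         (trans (cong₂ _+_ p q) (sym (ℤ.*-distribˡ-+ (2^ w) c d))))
  Integral-mean {w} (neg {G} g eq)  =
    let c , p = Integral-mean g
    in - c , trans (cubeSum-cong eq) (trans (cubeSum-neg G)
         (trans (cong -_ p) (ℤ.neg-distribʳ-* (2^ w) c)))

  Integral-hyperplane : ∀ {F} {S : Vec Bool (suc w)} (nz : Nonzero S) → Integral F → Integral (F ∘ hyperplane nz)
  Integral-hyperplane nz (char A eq)   =
    char (pullback nz A) (λ s → trans (eq _) (cong sign (dot-hyperplane nz A s)))
  Integral-hyperplane nz (plus g h eq) =
    plus (Integral-hyperplane nz g) (Integral-hyperplane nz h) (eq ∘ hyperplane nz)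
  Integral-hyperplane nz (neg g eq)    = neg (Integral-hyperplane nz g) (eq ∘ hyperplane nz)

  Integral-prepend : ∀ {G : Vec Bool w → ℤ} a → Integral G → Integral {suc w} (λ s → sign (a ∧ Vec.head s) * G (Vec.tail s))
  Integral-prepend a (char A eq) = char (a ∷ A)
    λ { (b ∷ s) → trans (cong (sign (a ∧ b) *_) (eq s)) (sym (sign-xor (a ∧ b) (dot A s))) }
    where
    sign-xor : ∀ x y → sign (x xor y) ≡ sign x * sign y
    sign-xor false y     = sym (ℤ.*-identityˡ (sign y))
    sign-xor true  false = refl
    sign-xor true  true  = refl
  Integral-prepend a (plus g h eq) = plus (Integral-prepend a g) (Integral-prepend a h)
    λ { (b ∷ s) → trans (cong (sign (a ∧ b) *_) (eq s)) (ℤ.*-distribˡ-+ (sign (a ∧ b)) _ _) }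
  Integral-prepend a (neg g eq)    = neg (Integral-prepend a g)
    λ { (b ∷ s) → trans (cong (sign (a ∧ b) *_) (eq s)) (sym (ℤ.neg-distribʳ-* (sign (a ∧ b)) _)) }

  Integral-one : Integral {w} (λ _ → 1ℤ)
  Integral-one = char origin (λ s → cong sign (sym (dot-originˡ s)))

  Integral-const : ∀ n → Integral {w} (λ _ → + n)
  Integral-const zero    = plus Integral-one (neg Integral-one λ _ → refl) (λ _ → refl)
  Integral-const (suc n) = plus Integral-one (Integral-const n) (λ _ → refl)

  -- Descent to a subspace on which the function vanishes.

  nonpositiveMean : (F : Vec Bool w → ℤ) → (∀ s → 0ℤ ≤ F s) →
    ∀ {c} → cubeSum F ≡ 2^ w * c → c ≤ 0ℤ → ∀ s → F s ≡ 0ℤ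
  nonpositiveMean {w} F F≥0 {c} mean c≤0 s = ℤ.≤-antisym (cubeSum≤0⇒≤0 F≥0 ∑F≤0 s) (F≥0 s)
    where
    ∑F≤0 : cubeSum F ≤ 0ℤ
    ∑F≤0 = subst₂ _≤_ (sym mean) (ℤ.*-zeroʳ (2^ w))
      (ℤ.*-monoˡ-≤-nonNeg (2^ w) {{ℤ.nonNegative (2^-nonNeg w)}} c≤0)

  -- Unnormalized: 2 ^ w times the Fourier coefficient at S.
  fourier : (Vec Bool w → ℤ) → Vec Bool w → ℤ
  fourier F S = cubeSum (λ s → F s * character S s)

  -- All the character sums add up to a multiple of F origin.
  negativeCharacterSum : (F : Vec Bool w → ℤ) → F origin ≡ 0ℤ →
    ∀ {c} → cubeSum F ≡ 2^ w * c → 0ℤ < c → ∃[ S ] (Nonzero S × fourier F S < 0ℤ)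
  negativeCharacterSum {w} F F0≡0 {c} mean c>0 = negativeAwayFromOrigin (fourier F)
    (ℤ.≤-reflexive (trans (fourierInversion F) (trans (cong (2^ w *_) F0≡0) (ℤ.*-zeroʳ (2^ w)))))
    (subst (0ℤ <_) (sym fourier-origin) ∑F>0)
    where
    ∑F>0 : 0ℤ < cubeSum F
    ∑F>0 = subst₂ _<_ (ℤ.*-zeroʳ (2^ w)) (sym mean)
      (ℤ.*-monoˡ-<-pos (2^ w) {{ℤ.positive (2^-pos w)}} c>0)
    fourier-origin : fourier F origin ≡ cubeSum F
    fourier-origin = cubeSum-cong λ s →
      trans (cong (λ b → F s * sign b) (dot-originˡ s)) (ℤ.*-identityʳ (F s))

  -- By `cubeSum-hyperplane`, twice the restricted sum is the full sum plus the negative character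
  -- sum; both sides are then divided by 2 ^ suc w.
  smallerMean : ∀ {S : Vec Bool (suc w)} (nz : Nonzero S) F {c c′} → fourier F S < 0ℤ →
    cubeSum F ≡ 2^ suc w * c → cubeSum (F ∘ hyperplane nz) ≡ 2^ w * c′ → c′ < c
  smallerMean {w} nz F {c} {c′} F̂S<0 mean mean′ = *-cancelˡ-<-2^ (suc w) (subst₂ _<_
    (trans (sym (cubeSum-hyperplane nz F)) (trans (cong (+ 2 *_) mean′) (sym (ℤ.*-assoc (+ 2) (2^ w) c′))))
    (trans (ℤ.+-identityʳ (cubeSum F)) mean)
    (ℤ.+-monoʳ-< (cubeSum F) F̂S<0))

  VanishesOnSubspace : ℕ → (Vec Bool w → ℤ) → Set
  VanishesOnSubspace {w} r F = Σ[ φ ∈ (Vec Bool r → Vec Bool w) ]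
    ((∀ {s t} → φ s ≡ φ t → s ≡ t) × φ origin ≡ origin × (∀ s → F (φ s) ≡ 0ℤ))

  -- On the hyperplane orthogonal to a character with negative sum the mean is
  -- a smaller integer.
  vanishingSubspace : ∀ k r (F : Vec Bool (k ℕ.+ r) → ℤ) → Integral F →
    (∀ s → 0ℤ ≤ F s) → F origin ≡ 0ℤ → ∀ {c} → cubeSum F ≡ 2^ (k ℕ.+ r) * c → c ≤ + k →
    VanishesOnSubspace r F
  vanishingSubspace zero    r F F-int F≥0 F0≡0 mean c≤k =
    (λ s → s) , (λ eq → eq) , refl , nonpositiveMean F F≥0 mean c≤k
  vanishingSubspace (suc k) r F F-int F≥0 F0≡0 {c} mean c≤k = split (c ℤ.≤? 0ℤ)
    where
    Goal = VanishesOnSubspace r F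

    restrict : ∀ {S} (nz : Nonzero S) {c′} → cubeSum (F ∘ hyperplane nz) ≡ 2^ (k ℕ.+ r) * c′ → c′ ≤ + k → Goal
    restrict nz mean′ c′≤k =
      let ψ , ψ-inj , ψ0 , Fψ = vanishingSubspace k r (F ∘ hyperplane nz) (Integral-hyperplane nz F-int)
            (λ s → F≥0 (hyperplane nz s)) (trans (cong F (hyperplane-origin nz)) F0≡0) mean′ c′≤k
      in (λ s → hyperplane nz (ψ s)) , (λ eq → ψ-inj (hyperplane-injective nz eq)) ,
         trans (cong (hyperplane nz) ψ0) (hyperplane-origin nz) , Fψ

    split : Dec (c ≤ 0ℤ) → Goal
    -- Here `F` is already identically zero and any hyperplane serves. One is still cut off, by
    -- setting the first coordinate to `false`, to end at dimension exactly `r`.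
    split (yes c≤0) = restrict e₀
      (trans (cubeSum-cong λ s → nonpositiveMean F F≥0 mean c≤0 (hyperplane e₀ s))
        (cubeSum-const (k ℕ.+ r) 0ℤ))
      (+≤+ z≤n)
      where e₀ = here {S = origin}
    split (no c≰0) =
      let S , nz , F̂S<0 = negativeCharacterSum F F0≡0 mean (ℤ.≰⇒> c≰0)
          c′ , mean′ = Integral-mean (Integral-hyperplane nz F-int)
      -- The restricted mean is an integer strictly below `c`, which is at most `suc k`; hence it is
      -- at most `k`.
      in restrict nz mean′ (ℤ.i<j⇒i≤pred[j] (ℤ.<-≤-trans (smallerMean nz F F̂S<0 mean mean′) c≤k))

  -- Subcubes

  Word : ℕ → Set
  Word = Vec (Maybe Bool)

  width : Word w → ℕ
  width []            = 0
  width (just _ ∷ v)  = suc (width v)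
  width (nothing ∷ v) = width v

  -- Scaled to have mean 1 over the two signs, so that the weight of a word has mean 1 whatever its
  -- width.
  letter : Maybe Bool → Bool → ℤ
  letter nothing      _     = 1ℤ
  letter (just false) false = + 2
  letter (just false) true  = 0ℤ
  letter (just true)  false = 0ℤ
  letter (just true)  true  = + 2

  -- 2 ^ width v times the indicator function of the subcube v.
  weight : Word w → Vec Bool w → ℤ
  weight []      []      = 1ℤ
  weight (a ∷ v) (b ∷ s) = letter a b * weight v s

  letter-sum : ∀ a → letter a false + letter a true ≡ + 2
  letter-sum nothing      = refl
  letter-sum (just false) = refl
  letter-sum (just true)  = refl

  letter-nonNeg : ∀ a b → 0ℤ ≤ letter a b
  letter-nonNeg nothing      _     = +≤+ z≤n
  letter-nonNeg (just false) false = +≤+ z≤n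
  letter-nonNeg (just false) true  = +≤+ z≤n
  letter-nonNeg (just true)  false = +≤+ z≤n
  letter-nonNeg (just true)  true  = +≤+ z≤n

  letter≤2 : ∀ a b → letter (just a) b ≤ + 2
  letter≤2 false false = ℤ.≤-refl
  letter≤2 false true  = +≤+ z≤n
  letter≤2 true  false = +≤+ z≤n
  letter≤2 true  true  = ℤ.≤-refl

  *-nonNeg : ∀ {i j} → 0ℤ ≤ i → 0ℤ ≤ j → 0ℤ ≤ i * j
  *-nonNeg {i} {j} i≥0 j≥0 =
    subst (_≤ i * j) (ℤ.*-zeroʳ i) (ℤ.*-monoˡ-≤-nonNeg i {{ℤ.nonNegative i≥0}} j≥0)

  weight-nonNeg : (v : Word w) (s : Vec Bool w) → 0ℤ ≤ weight v s
  weight-nonNeg []      []      = +≤+ z≤n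
  weight-nonNeg (a ∷ v) (b ∷ s) = *-nonNeg (letter-nonNeg a b) (weight-nonNeg v s)

  weight≤2^width : (v : Word w) (s : Vec Bool w) → weight v s ≤ 2^ width v
  weight≤2^width []            []      = ℤ.≤-refl
  weight≤2^width (nothing ∷ v) (b ∷ s) = subst (_≤ 2^ width v) (sym (ℤ.*-identityˡ (weight v s))) (weight≤2^width v s)
  weight≤2^width (just a ∷ v)  (b ∷ s) = ℤ.≤-trans
    (ℤ.*-monoʳ-≤-nonNeg (weight v s) {{ℤ.nonNegative (weight-nonNeg v s)}} (letter≤2 a b))
    (ℤ.*-monoˡ-≤-nonNeg (+ 2) (weight≤2^width v s))

  2^-mono : m ℕ.≤ n → 2^ m ≤ 2^ n
  2^-mono {n = zero}  z≤n = ℤ.≤-refl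
  2^-mono {n = suc n} z≤n = ℤ.≤-trans (2^-mono {n = n} z≤n)
    (subst (_≤ 2^ suc n) (ℤ.*-identityˡ (2^ n))
      (ℤ.*-monoʳ-≤-nonNeg (2^ n) {{ℤ.nonNegative (2^-nonNeg n)}} (+≤+ {1} {2} (s≤s z≤n))))
  2^-mono (s≤s m≤n) = ℤ.*-monoˡ-≤-nonNeg (+ 2) (2^-mono m≤n)

  cubeSum-weight : (v : Word w) → cubeSum (weight v) ≡ 2^ w
  cubeSum-weight []              = refl
  cubeSum-weight {suc w} (a ∷ v) = trans
    (cong₂ _+_ (cubeSum-* (letter a false) (weight v)) (cubeSum-* (letter a true) (weight v)))
    (trans (sym (ℤ.*-distribʳ-+ (cubeSum (weight v)) (letter a false) (letter a true)))
      (cong₂ _*_ (letter-sum a) (cubeSum-weight v)))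

  -- Averaging over the last `n` coordinates replaces each of their letters by its mean 1.
  cubeSum-weight-++ : ∀ m {n} (v : Word (m ℕ.+ n)) (s : Vec Bool m) →
    cubeSum (λ (t : Vec Bool n) → weight v (s ++ t)) ≡ 2^ n * weight (Vec.take m v) s
  cubeSum-weight-++ zero        v       []      = trans (cubeSum-weight v) (sym (ℤ.*-identityʳ _))
  cubeSum-weight-++ (suc m) {n} (a ∷ v) (b ∷ s) = trans
    (cubeSum-* (letter a b) (λ t → weight v (s ++ t)))
    (trans (cong (letter a b *_) (cubeSum-weight-++ m v s)) (swap (letter a b) (2^ n) _))
    where
    swap : ∀ x y z → x * (y * z) ≡ y * (x * z)
    swap = solve-∀

  weight-mismatch : ∀ (v : Word w) s i {b} → lookup v i ≡ just b → lookup s i ≡ not b → weight v s ≡ 0ℤ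
  weight-mismatch (just false ∷ v) (true ∷ s)  zero    refl refl = refl
  weight-mismatch (just true ∷ v)  (false ∷ s) zero    refl refl = refl
  weight-mismatch (just false ∷ v) (false ∷ s) zero    refl ()
  weight-mismatch (just true ∷ v)  (true ∷ s)  zero    refl ()
  weight-mismatch (a ∷ v)          (b ∷ s)     (suc i) p    q    =
    trans (cong (letter a b *_) (weight-mismatch v s i p q)) (ℤ.*-zeroʳ (letter a b))

  Clash : Word w → Word w → Set
  Clash u v = ∃[ i ] ∃[ b ] (lookup u i ≡ just b × lookup v i ≡ just (not b))

  Clash⇒weight≡0 : (u v : Word w) (s : Vec Bool w) → Clash u v → weight u s ≡ 0ℤ ⊎ weight v s ≡ 0ℤ
  Clash⇒weight≡0 u v s (i , b , ub , v¬b) with lookup s i in eq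
  Clash⇒weight≡0 u v s (i , false , ub , v¬b) | false = inj₂ (weight-mismatch v s i v¬b eq)
  Clash⇒weight≡0 u v s (i , false , ub , v¬b) | true  = inj₁ (weight-mismatch u s i ub eq)
  Clash⇒weight≡0 u v s (i , true  , ub , v¬b) | false = inj₁ (weight-mismatch u s i ub eq)
  Clash⇒weight≡0 u v s (i , true  , ub , v¬b) | true  = inj₂ (weight-mismatch v s i v¬b eq)

  -- The letter `just false` is 1 plus the sign character of its coordinate, and `just true` is 1
  -- minus it.
  Integral-letter : ∀ {G : Vec Bool w → ℤ} a → Integral G →
    Integral (λ s → letter a (Vec.head s) * G (Vec.tail s))
  Integral-letter nothing      g = Integral-prepend false g
  Integral-letter {G = G} (just false) g = plus (Integral-prepend false g) (Integral-prepend true g)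
    λ { (false ∷ s) → double (G s) ; (true ∷ s) → cancel (G s) }
    where
    double : ∀ x → + 2 * x ≡ 1ℤ * x + 1ℤ * x
    double = solve-∀
    cancel : ∀ x → 0ℤ * x ≡ 1ℤ * x + -1ℤ * x
    cancel = solve-∀
  Integral-letter {G = G} (just true)  g = plus (Integral-prepend false g) (neg (Integral-prepend true g) (λ _ → refl))
    λ { (false ∷ s) → cancel (G s) ; (true ∷ s) → double (G s) }
    where
    double : ∀ x → + 2 * x ≡ 1ℤ * x + - (-1ℤ * x)
    double = solve-∀
    cancel : ∀ x → 0ℤ * x ≡ 1ℤ * x + - (1ℤ * x)
    cancel = solve-∀

  Integral-cong : ∀ {F G : Vec Bool w → ℤ} → F ≗ G → Integral G → Integral F
  Integral-cong eq (char A p)   = char A (λ s → trans (eq s) (p s))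
  Integral-cong eq (plus g h p) = plus g h (λ s → trans (eq s) (p s))
  Integral-cong eq (neg g p)    = neg g (λ s → trans (eq s) (p s))

  Integral-weight : (v : Word w) → Integral (weight v)
  Integral-weight []      = char [] λ { [] → refl }
  Integral-weight (a ∷ v) = Integral-cong (λ { (b ∷ s) → refl }) (Integral-letter a (Integral-weight v))

  totalWeight : List (Word w) → Vec Bool w → ℤ
  totalWeight []       s = 0ℤ
  totalWeight (v ∷ vs) s = weight v s + totalWeight vs s

  Integral-totalWeight : (vs : List (Word w)) → Integral (totalWeight vs)
  Integral-totalWeight []       = Integral-const 0
  Integral-totalWeight (v ∷ vs) = plus (Integral-weight v) (Integral-totalWeight vs) (λ _ → refl)

  cubeSum-totalWeight : (vs : List (Word w)) → cubeSum (totalWeight vs) ≡ 2^ w * + List.length vs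
  cubeSum-totalWeight {w} []       = cubeSum-const w 0ℤ
  cubeSum-totalWeight {w} (v ∷ vs) = trans (cubeSum-+ (weight v) (totalWeight vs))
    (trans (cong₂ _+_ (cubeSum-weight v) (cubeSum-totalWeight vs))
      (sym (ℤ.*-suc (2^ w) (+ List.length vs))))

  cubeSum-totalWeight-++ : ∀ m {n} (vs : List (Word (m ℕ.+ n))) (s : Vec Bool m) →
    cubeSum (λ (t : Vec Bool n) → totalWeight vs (s ++ t)) ≡ 2^ n * totalWeight (List.map (Vec.take m) vs) s
  cubeSum-totalWeight-++ m {n} []       s = cubeSum-const n 0ℤ
  cubeSum-totalWeight-++ m {n} (v ∷ vs) s = trans
    (cubeSum-+ {n} (λ t → weight v (s ++ t)) _)
    (trans (cong₂ _+_ (cubeSum-weight-++ m v s) (cubeSum-totalWeight-++ m vs s))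
      (sym (ℤ.*-distribˡ-+ (2^ n) (weight (Vec.take m v) s) _)))

  totalWeight≡0 : ∀ {vs} {s : Vec Bool w} → All (λ v → weight v s ≡ 0ℤ) vs → totalWeight vs s ≡ 0ℤ
  totalWeight≡0 []       = refl
  totalWeight≡0 (p ∷ ps) = cong₂ _+_ p (totalWeight≡0 ps)

  -- Clashing words have disjoint subcubes, so at most one word contributes at `s`.
  totalWeight≤2^ : ∀ {vs : List (Word w)} → AllPairs Clash vs → All (λ v → width v ℕ.≤ n) vs →
    ∀ s → totalWeight vs s ≤ 2^ n
  totalWeight≤2^ {n = n} [] [] s = 2^-nonNeg n
  totalWeight≤2^ {n = n} {v ∷ vs} (clash ∷ clashes) (≤n ∷ widths) s with weight v s ℤ.≟ 0ℤ
  ... | yes v≡0 = subst (_≤ 2^ n) (sym (trans (cong (_+ totalWeight vs s) v≡0) (ℤ.+-identityˡ _)))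
    (totalWeight≤2^ clashes widths s)
  ... | no v≢0  = subst (_≤ 2^ n)
    (sym (trans (cong (λ z → weight v s + z) (totalWeight≡0 (All.map (λ {u} → vanish u) clash))) (ℤ.+-identityʳ _)))
    (ℤ.≤-trans (weight≤2^width v s) (2^-mono ≤n))
    where
    vanish : ∀ u → Clash v u → weight u s ≡ 0ℤ
    vanish u c with Clash⇒weight≡0 v u s c
    ... | inj₁ v≡0 = contradiction v≡0 v≢0
    ... | inj₂ u≡0 = u≡0

  -- The word of the distinguished simplex, whose facets occupy the first `m` coordinates with
  -- positive sign.
  prefixWord : ∀ m n → Word (m ℕ.+ n)
  prefixWord m n = replicate m (just false) ++ replicate n nothing

  width-prefixWord : ∀ m n → width (prefixWord m n) ≡ m
  width-prefixWord zero    zero    = refl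
  width-prefixWord zero    (suc n) = width-prefixWord zero n
  width-prefixWord (suc m) n       = cong suc (width-prefixWord m n)

  weight-prefixWord : ∀ m n (t : Vec Bool n) → weight (prefixWord m n) (origin {m} ++ t) ≡ 2^ m
  weight-prefixWord zero    zero    []      = refl
  weight-prefixWord zero    (suc n) (b ∷ t) = trans (ℤ.*-identityˡ _) (weight-prefixWord zero n t)
  weight-prefixWord (suc m) n       t       = cong (+ 2 *_) (weight-prefixWord m n t)

  weight-prefixWord-≢ : ∀ m n {s} → Nonzero s → (t : Vec Bool n) → weight (prefixWord m n) (s ++ t) ≡ 0ℤ
  weight-prefixWord-≢ (suc m) n here       t = refl
  weight-prefixWord-≢ (suc m) n (there nz) t = cong (+ 2 *_) (weight-prefixWord-≢ m n nz t)

  -- Excluded along with `origin` because its signs are not mixed: no direction makes all the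
  -- barycentric coordinates negative.
  antipode : Vec Bool w
  antipode = replicate _ true

  -- The function to which the descent applies is the average of the uncovered
  -- part over the last n coordinates.
  coveredFibre : ∀ k {m n} → k ℕ.+ 2 ≡ m → (vs : List (Word (m ℕ.+ n))) →
    AllPairs Clash (prefixWord m n ∷ vs) → All (λ v → width v ℕ.≤ m) vs →
    2 ℕ.^ m ℕ.≤ k ℕ.+ suc (List.length vs) →
    Σ[ s ∈ Vec Bool m ] (Nonzero s × s ≢ antipode ×
      (∀ (t : Vec Bool n) → ¬ All (λ v → weight v (s ++ t) ≡ 0ℤ) vs))
  coveredFibre k {n = n} refl vs clash@(prefixClash ∷ clashes) widths large =
    -- After `k` descents from k + 2 a plane is left. It offers two distinct nonzero vectors, and at
    -- least one of them is not the antipode.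
    choose (vanishingSubspace k 2 mean mean-int mean≥0 mean-origin cubeSum-mean mean≤k)
    where
    dim = k ℕ.+ 2
    us = prefixWord dim n ∷ vs
    -- At an uncovered point `gap` has its full value 2 ^ dim; at covered points only its
    -- nonnegativity is established.
    gap : Vec Bool (dim ℕ.+ n) → ℤ
    gap x = 2^ dim + - totalWeight us x
    mean : Vec Bool dim → ℤ
    mean s = 2^ dim + - totalWeight (List.map (Vec.take dim) us) s

    gap≥0 : ∀ x → 0ℤ ≤ gap x
    gap≥0 x = ℤ.i≤j⇒0≤j-i (totalWeight≤2^ clash (ℕ.≤-reflexive (width-prefixWord dim n) ∷ widths) x)

    cubeSum-gap : ∀ s → cubeSum (λ t → gap (s ++ t)) ≡ 2^ n * mean s
    cubeSum-gap s = trans (cubeSum-+ {n} (λ _ → 2^ dim) _)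
      (trans (cong₂ _+_ (cubeSum-const n (2^ dim))
        (trans (cubeSum-neg (λ t → totalWeight us (s ++ t)))
          (trans (cong -_ (cubeSum-totalWeight-++ dim us s)) (ℤ.neg-distribʳ-* (2^ n) _))))
        (sym (ℤ.*-distribˡ-+ (2^ n) (2^ dim) _)))

    mean≥0 : ∀ s → 0ℤ ≤ mean s
    mean≥0 s = *-cancelˡ-≤-2^ n (subst₂ _≤_ (sym (ℤ.*-zeroʳ (2^ n))) (cubeSum-gap s)
      (cubeSum-nonNeg (λ t → gap≥0 (s ++ t))))

    -- Over the origin the prefix word alone accounts for 2 ^ dim, and every word clashing with it
    -- vanishes.
    gap-origin : ∀ t → gap (origin {dim} ++ t) ≡ 0ℤ
    gap-origin t = trans (cong (λ z → 2^ dim + - z)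
      (trans (cong₂ _+_ (weight-prefixWord dim n t) (totalWeight≡0 (All.map (λ {v} → vanish v) prefixClash)))
        (ℤ.+-identityʳ (2^ dim)))) (ℤ.+-inverseʳ (2^ dim))
      where
      vanish : ∀ v → Clash (prefixWord dim n) v → weight v (origin {dim} ++ t) ≡ 0ℤ
      vanish v c with Clash⇒weight≡0 (prefixWord dim n) v (origin {dim} ++ t) c
      ... | inj₁ p = contradiction (trans (sym p) (weight-prefixWord dim n t)) (ℤ.<⇒≢ (2^-pos dim))
      ... | inj₂ p = p

    mean-origin : mean origin ≡ 0ℤ
    mean-origin = ℤ.*-cancelˡ-≡ (2^ n) (mean origin) 0ℤ {{ℤ.≢-nonZero (≢-sym (ℤ.<⇒≢ (2^-pos n)))}}
      (trans (sym (cubeSum-gap origin)) (trans (cubeSum-cong gap-origin) (cubeSum-const n 0ℤ)))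

    mean-int : Integral mean
    mean-int = plus (Integral-cong (λ _ → 2^-+ dim) (Integral-const (2 ℕ.^ dim)))
      (neg (Integral-totalWeight (List.map (Vec.take dim) us)) (λ _ → refl)) (λ _ → refl)

    cubeSum-mean : cubeSum mean ≡ 2^ dim * (2^ dim + - (+ List.length us))
    cubeSum-mean = trans (cubeSum-+ {dim} (λ _ → 2^ dim) _)
      (trans (cong₂ _+_ (cubeSum-const dim (2^ dim))
        (trans (cubeSum-neg (totalWeight (List.map (Vec.take dim) us)))
          (trans (cong -_ (trans (cubeSum-totalWeight (List.map (Vec.take dim) us))
            (cong (λ l → 2^ dim * + l) (List.length-map (Vec.take dim) us))))
            (ℤ.neg-distribʳ-* (2^ dim) (+ List.length us)))))
        (sym (ℤ.*-distribˡ-+ (2^ dim) (2^ dim) _)))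

    mean≤k : 2^ dim + - (+ List.length us) ≤ + k
    mean≤k = subst₂ _≤_ (cong (_+ - (+ List.length us)) (sym (2^-+ dim))) (cancel (+ k) (+ List.length us))
      (ℤ.+-monoˡ-≤ (- (+ List.length us)) (+≤+ large))
      where
      cancel : ∀ x y → x + y + - y ≡ x
      cancel = solve-∀

    -- A nonnegative `gap` of average zero over the fibre vanishes on all of it. Since the prefix
    -- word does not reach a nonzero `s`, a point missed by all of `vs` would have gap 2 ^ dim.
    covered : ∀ {s} → Nonzero s → mean s ≡ 0ℤ → ∀ t → ¬ All (λ v → weight v (s ++ t) ≡ 0ℤ) vs
    covered {s} nz Fs≡0 t zeros = ℤ.<⇒≱ (2^-pos dim) (subst (_≤ 0ℤ)
      (trans (cong (λ z → 2^ dim + - z) (totalWeight≡0 {vs = us} (weight-prefixWord-≢ dim n nz t ∷ zeros))) (ℤ.+-identityʳ (2^ dim)))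
      (cubeSum≤0⇒≤0 (λ t → gap≥0 (s ++ t))
        (ℤ.≤-reflexive (trans (cubeSum-gap s) (trans (cong (2^ n *_) Fs≡0) (ℤ.*-zeroʳ (2^ n))))) t))

    choose : VanishesOnSubspace 2 mean → Σ[ s ∈ Vec Bool dim ] (Nonzero s × s ≢ antipode ×
      (∀ (t : Vec Bool n) → ¬ All (λ v → weight v (s ++ t) ≡ 0ℤ) vs))
    choose (φ , φ-inj , φ0 , meanφ) with Vec.≡-dec Bool._≟_ (φ (true ∷ false ∷ [])) antipode
    ... | no ≢antipode = φ (true ∷ false ∷ []) , nz , ≢antipode , covered nz (meanφ _)
      where nz = ≢origin⇒Nonzero (φ (true ∷ false ∷ [])) λ eq → case φ-inj (trans eq (sym φ0)) of λ ()
    ... | yes ≡antipode = φ (false ∷ true ∷ []) , nz ,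
        (λ eq → case φ-inj (trans eq (sym ≡antipode)) of λ ()) , covered nz (meanφ _)
      where nz = ≢origin⇒Nonzero (φ (false ∷ true ∷ [])) λ eq → case φ-inj (trans eq (sym φ0)) of λ ()

  wordOf : (Fin m → Fin n) → (Fin m → Bool) → Word n
  wordOf {zero}  r t = replicate _ nothing
  wordOf {suc m} r t = wordOf (r ∘ suc) (t ∘ suc) Vec.[ r zero ]≔ just (t zero)

  width-[]≔ : ∀ (v : Word n) i a → width (v Vec.[ i ]≔ a) ℕ.≤ suc (width v)
  width-[]≔ (just _ ∷ v)  zero    (just _) = ℕ.n≤1+n _
  width-[]≔ (just _ ∷ v)  zero    nothing  = ℕ.≤-trans (ℕ.n≤1+n _) (ℕ.n≤1+n _)
  width-[]≔ (nothing ∷ v) zero    (just _) = ℕ.≤-refl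
  width-[]≔ (nothing ∷ v) zero    nothing  = ℕ.n≤1+n _
  width-[]≔ (just _ ∷ v)  (suc i) a        = s≤s (width-[]≔ v i a)
  width-[]≔ (nothing ∷ v) (suc i) a        = width-[]≔ v i a

  width-replicate : ∀ n → width (replicate n nothing) ≡ 0
  width-replicate zero    = refl
  width-replicate (suc n) = width-replicate n

  width-wordOf : (r : Fin m → Fin n) (t : Fin m → Bool) → width (wordOf r t) ℕ.≤ m
  width-wordOf {zero}  {n} r t = ℕ.≤-reflexive (width-replicate n)
  width-wordOf {suc m}     r t = ℕ.≤-trans (width-[]≔ (wordOf (r ∘ suc) (t ∘ suc)) (r zero) _)
    (s≤s (width-wordOf (r ∘ suc) (t ∘ suc)))

  lookup-wordOf : (r : Fin m → Fin n) (t : Fin m → Bool) → (∀ {i j} → r i ≡ r j → i ≡ j) →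
    ∀ i → lookup (wordOf r t) (r i) ≡ just (t i)
  lookup-wordOf r t r-inj zero    = Vec.lookup∘updateAt (r zero) (wordOf (r ∘ suc) (t ∘ suc))
  lookup-wordOf r t r-inj (suc i) = trans
    (Vec.lookup∘updateAt′ (r (suc i)) (r zero) (λ eq → case r-inj eq of λ ()) (wordOf (r ∘ suc) (t ∘ suc)))
    (lookup-wordOf (r ∘ suc) (t ∘ suc) (λ eq → Fin.suc-injective (r-inj eq)) i)

  lookup-prefixWord : ∀ m n i → lookup (prefixWord m n) (i ↑ˡ n) ≡ just false
  lookup-prefixWord (suc m) n zero    = refl
  lookup-prefixWord (suc m) n (suc i) = lookup-prefixWord m n i

  Nonzero⇒∃true : {s : Vec Bool w} → Nonzero s → ∃[ i ] lookup s i ≡ true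
  Nonzero⇒∃true here       = zero , refl
  Nonzero⇒∃true (there nz) = let i , eq = Nonzero⇒∃true nz in suc i , eq

  ≢antipode⇒∃false : (s : Vec Bool w) → s ≢ antipode → ∃[ i ] lookup s i ≡ false
  ≢antipode⇒∃false []          s≢ = contradiction refl s≢
  ≢antipode⇒∃false (false ∷ s) s≢ = zero , refl
  ≢antipode⇒∃false (true ∷ s)  s≢ = let i , eq = ≢antipode⇒∃false s (s≢ ∘ cong (true ∷_)) in suc i , eq

-- Case distinctions under a double negation, and finite searches.

module DoubleNegation where

  infixl 1 _>>=_

  _>>=_ : ∀ {a b} {A : Set a} {B : Set b} → ¬ ¬ A → (A → ¬ ¬ B) → ¬ ¬ B
  (¬¬a >>= f) ¬b = ¬¬a λ a → f a ¬b

  pure : ∀ {a} {A : Set a} → A → ¬ ¬ A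
  pure a ¬a = ¬a a

  -- Finiteness of the index set allows the double negations to be drawn out of the quantifier one
  -- at a time.
  ¬¬-all : ∀ {n p} {P : Fin n → Set p} → (∀ i → ¬ ¬ P i) → ¬ ¬ (∀ i → P i)
  ¬¬-all {zero}  ¬¬P = pure λ ()
  ¬¬-all {suc n} ¬¬P = do
    p₀ ← ¬¬P zero
    p₊ ← ¬¬-all (¬¬P ∘ suc)
    pure λ { zero → p₀ ; (suc i) → p₊ i }

open DoubleNegation

search : ∀ {n p q} {P : Fin n → Set p} {Q : Fin n → Set q} →
  (∀ i → P i ⊎ Q i) → (∃[ i ] P i) ⊎ (∀ i → Q i)
search {zero}  p⊎q = inj₂ λ ()
search {suc n} p⊎q with p⊎q zero | search (p⊎q ∘ suc)
... | inj₁ p | _             = inj₁ (zero , p)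
... | inj₂ _ | inj₁ (i , p)  = inj₁ (suc i , p)
... | inj₂ q | inj₂ qs       = inj₂ λ { zero → q ; (suc i) → qs i }

least : ∀ {n p} {P : Fin n → Set p} → (∀ i → Dec (P i)) → ∃[ i ] P i →
  ∃[ i ] (P i × (∀ j → P j → i Fin.≤ j))
least {suc n} P? (i , p) with P? zero | i
... | yes p₀ | _     = zero , p₀ , λ _ _ → z≤n
... | no ¬p₀ | zero  = contradiction p ¬p₀
... | no ¬p₀ | suc i =
  let j , q , minimal = least (P? ∘ suc) (i , p)
  in suc j , q , λ { zero p₀ → contradiction p₀ ¬p₀ ; (suc l) r → s≤s (minimal l r) }

-- Geometry over the real numbers.

module Geometry {c ℓ₁ ℓ₂ : Level} (R : RealNumbers c ℓ₁ ℓ₂) where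

  open import Algebra.Bundles using (CommutativeRing)
  open import Data.Nat.Base using (_≤_; _^_)
  open import Data.Vec.Functional as Vector using (Vector)
  import Data.Vec.Functional.Properties as Vector
  open import Function.Bundles using (Equivalence)
  open import Relation.Binary.Structures using (IsStrictPartialOrder)
  open Cube using (Word; prefixWord; lookup-prefixWord; wordOf; width-wordOf; lookup-wordOf;
    Clash; weight; weight-mismatch; Nonzero⇒∃true; ≢antipode⇒∃false; coveredFibre)

  open RealNumbers R hiding (ring; zero; _≤_)
  open Simplices R
  private module R = CommutativeRing (RealNumbers.ring R)
  open import Algebra.Apartness.Properties.HeytingCommutativeRing heytingCommutativeRing
    using (1#0; x-0≈x; #-congʳ)
  open import Algebra.Properties.Group R.+-group using (inverseˡ-unique)
  open import Algebra.Properties.Ring R.ring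
    using (-‿distribˡ-*; -‿distribʳ-*; -‿involutive; -1*x≈-x)
  open import Algebra.Properties.Semiring.Sum R.semiring
    using (sum-cong-≋; ∑-distrib-+; ∑-comm; *-distribˡ-sum; *-distribʳ-sum; sum-remove; sum-replicate-zero)
  open import Relation.Binary.Reasoning.Setoid R.setoid
  open IsStrictPartialOrder isStrictPartialOrder
    using (<-resp-≈) renaming (trans to <-trans; irrefl to <-irrefl)

  -- Order

  <-respʳ : ∀ {x y z} → y ≈ z → x < y → x < z
  <-respʳ = proj₁ <-resp-≈

  <-respˡ : ∀ {x y z} → y ≈ z → y < x → z < x
  <-respˡ = proj₂ <-resp-≈

  pos-+ : ∀ {x y} → 0# < x → 0# < y → 0# < x + y
  pos-+ {x} {y} x>0 y>0 = <-trans y>0 (<-respˡ (+-identityˡ y) (+-monoˡ-< y x>0))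

  neg⇒pos : ∀ {x} → x < 0# → 0# < - x
  neg⇒pos {x} x<0 = <-respˡ (-‿inverseʳ x) (<-respʳ (+-identityˡ (- x)) (+-monoˡ-< (- x) x<0))

  pos⇒neg : ∀ {x} → 0# < - x → x < 0#
  pos⇒neg {x} -x>0 = <-respˡ (+-identityˡ x) (<-respʳ (-‿inverseˡ x) (+-monoˡ-< x -x>0))

  neg-*ʳ : ∀ {x y} → 0# < x → y < 0# → x * y < 0#
  neg-*ʳ {x} {y} x>0 y<0 = pos⇒neg (<-respʳ (sym (-‿distribʳ-* x y)) (*-pos x>0 (neg⇒pos y<0)))

  neg-*ˡ : ∀ {x y} → x < 0# → 0# < y → x * y < 0#
  neg-*ˡ x<0 y>0 = <-respˡ (*-comm _ _) (neg-*ʳ y>0 x<0)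

  neg-* : ∀ {x y} → x < 0# → y < 0# → 0# < x * y
  neg-* {x} {y} x<0 y<0 = <-respʳ
    (trans (sym (-‿distribʳ-* (- x) y)) (trans (-‿cong (sym (-‿distribˡ-* x y))) (-‿involutive (x * y))))
    (*-pos (neg⇒pos x<0) (neg⇒pos y<0))

  #0⇒<⊎> : ∀ {x} → x # 0# → x < 0# ⊎ 0# < x
  #0⇒<⊎> = Equivalence.to #⇔<⊎>

  >0⇒#0 : ∀ {x} → 0# < x → x # 0#
  >0⇒#0 x>0 = Equivalence.from #⇔<⊎> (inj₂ x>0)

  <0⇒#0 : ∀ {x} → x < 0# → x # 0#
  <0⇒#0 x<0 = Equivalence.from #⇔<⊎> (inj₁ x<0)

  0<1 : 0# < 1#
  0<1 with #0⇒<⊎> 1#0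
  ... | inj₂ p = p
  ... | inj₁ p = <-respʳ (*-identityˡ 1#) (neg-* p p)

  0≉1 : ¬ 0# ≈ 1#
  0≉1 0≈1 = <-irrefl 0≈1 0<1

  -- Equality is the negation of apartness. Equations may therefore be proved from case distinctions
  -- available only under a double negation.
  ≈-stable : ∀ {x y} → ¬ ¬ (x ≈ y) → x ≈ y
  ≈-stable ¬¬x≈y = proj₁ (tight _ _) λ x#y → ¬¬x≈y λ x≈y → #-irrefl x≈y x#y

  compare0 : ∀ x → ¬ ¬ (x < 0# ⊎ x ≈ 0# ⊎ 0# < x)
  compare0 x k = k (inj₂ (inj₁ (proj₁ (tight _ _) λ x#0 → k ([ inj₁ , inj₂ ∘ inj₂ ]′ (#0⇒<⊎> x#0)))))

  NonNeg : Carrier → Set ℓ₂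
  NonNeg x = ¬ (x < 0#)

  nonNeg-split : ∀ {x} → NonNeg x → ¬ ¬ (x ≈ 0# ⊎ 0# < x)
  nonNeg-split {x} x≥0 = compare0 x >>= λ
    { (inj₁ x<0) → contradiction x<0 x≥0 ; (inj₂ p) → pure p }

  inverse : ∀ {x} → x # 0# → ∃[ y ] y * x ≈ 1#
  inverse {x} x#0 = let y , yx , _ = #⇒invertible x#0 in y , trans (*-congˡ (sym (x-0≈x x))) yx

  -- Signs, with true standing for negative

  HasSign : Bool → Carrier → Set ℓ₂
  HasSign false x = 0# < x
  HasSign true  x = x < 0#

  HasSign-resp : ∀ b {x y} → x ≈ y → HasSign b x → HasSign b y
  HasSign-resp false = <-respʳ
  HasSign-resp true  = <-respˡ

  HasSign-* : ∀ a b {x y} → HasSign a x → HasSign b y → HasSign (a xor b) (x * y)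
  HasSign-* false false = *-pos
  HasSign-* false true  = neg-*ʳ
  HasSign-* true  false = neg-*ˡ
  HasSign-* true  true  = neg-*

  HasSign-unique : ∀ a b {x} → HasSign a x → HasSign b x → a ≡ b
  HasSign-unique false false p q = ≡.refl
  HasSign-unique false true  p q = contradiction (<-trans p q) (<-irrefl refl)
  HasSign-unique true  false p q = contradiction (<-trans q p) (<-irrefl refl)
  HasSign-unique true  true  p q = ≡.refl

  HasSign⇒#0 : ∀ b {x} → HasSign b x → x # 0#
  HasSign⇒#0 false = >0⇒#0
  HasSign⇒#0 true  = <0⇒#0

  #0⇒HasSign : ∀ {x} → x # 0# → ∃[ b ] HasSign b x
  #0⇒HasSign x#0 with #0⇒<⊎> x#0
  ... | inj₁ p = true , p
  ... | inj₂ p = false , p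

  -- The product 1 is positive, so the signs of the factors agree.
  HasSign-inverse : ∀ b {x y} → x * y ≈ 1# → HasSign b x → HasSign b y
  HasSign-inverse b {x} {y} xy≈1 px with #0⇒HasSign y#0
    where
    y#0 : y # 0#
    y#0 = invertible⇒# (x , trans (*-congˡ (x-0≈x y)) xy≈1 , trans (*-congʳ (x-0≈x y)) (trans (*-comm y x) xy≈1))
  ... | b′ , py = ≡.subst (λ b → HasSign b y) (≡.sym (xor≡false b b′ (HasSign-unique (b xor b′) false
          (HasSign-* b b′ px py) (<-respʳ (sym xy≈1) 0<1)))) py
    where
    xor≡false : ∀ a b → a xor b ≡ false → a ≡ b
    xor≡false false false _ = ≡.refl
    xor≡false true  true  _ = ≡.refl

  -- Finite sums.

  sum-zero : ∀ {n} (f : Vector Carrier n) → (∀ i → f i ≈ 0#) → sum f ≈ 0#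
  sum-zero {n} f f≈0 = trans (sum-cong-≋ f≈0) (sum-replicate-zero n)

  sum-pos : ∀ {n} (f : Vector Carrier (suc n)) → (∀ i → 0# < f i) → 0# < sum f
  sum-pos {zero}  f f>0 = <-respʳ (sym (+-identityʳ (f zero))) (f>0 zero)
  sum-pos {suc n} f f>0 = pos-+ (f>0 zero) (sum-pos (f ∘ suc) (f>0 ∘ suc))

  nonNeg-+ : ∀ {x y} → NonNeg x → NonNeg y → NonNeg (x + y)
  nonNeg-+ {x} {y} x≥0 y≥0 x+y<0 = (do
    p ← nonNeg-split x≥0
    q ← nonNeg-split y≥0
    pure (p , q)) λ
    { (inj₁ x≈0 , _)        → y≥0 (<-respˡ (trans (+-congʳ x≈0) (+-identityˡ y)) x+y<0)
    ; (_ , inj₁ y≈0)        → x≥0 (<-respˡ (trans (+-congˡ y≈0) (+-identityʳ x)) x+y<0)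
    ; (inj₂ x>0 , inj₂ y>0) → <-irrefl refl (<-trans (pos-+ x>0 y>0) x+y<0) }

  nonNeg-+≈0 : ∀ {x y} → NonNeg x → NonNeg y → x + y ≈ 0# → x ≈ 0# × y ≈ 0#
  nonNeg-+≈0 {x} {y} x≥0 y≥0 x+y≈0 = x≈0 , trans (sym (+-identityˡ y)) (trans (+-congʳ (sym x≈0)) x+y≈0)
    where
    x≈0 : x ≈ 0#
    x≈0 = ≈-stable (nonNeg-split x≥0 >>= λ
      { (inj₁ x≈0) → pure x≈0
      ; (inj₂ x>0) → λ _ → y≥0 (<-respʳ x+y≈0 (<-respˡ (+-identityˡ y) (+-monoˡ-< y x>0))) })

  sum-nonNeg : ∀ {n} (f : Vector Carrier n) → (∀ i → NonNeg (f i)) → NonNeg (sum f)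
  sum-nonNeg {zero}  f f≥0 = <-irrefl refl
  sum-nonNeg {suc n} f f≥0 = nonNeg-+ (f≥0 zero) (sum-nonNeg (f ∘ suc) (f≥0 ∘ suc))

  sum-nonNeg≈0 : ∀ {n} (f : Vector Carrier n) → (∀ i → NonNeg (f i)) → sum f ≈ 0# → ∀ i → f i ≈ 0#
  sum-nonNeg≈0 {suc n} f f≥0 ∑≈0 i
    with nonNeg-+≈0 (f≥0 zero) (sum-nonNeg (f ∘ suc) (f≥0 ∘ suc)) ∑≈0 | i
  ... | f₀≈0 , _ | zero  = f₀≈0
  ... | _ , ∑′≈0 | suc i = sum-nonNeg≈0 (f ∘ suc) (f≥0 ∘ suc) ∑′≈0 i

  δ : ∀ {n} → Fin n → Fin n → Carrier
  δ zero    zero    = 1#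
  δ zero    (suc j) = 0#
  δ (suc i) zero    = 0#
  δ (suc i) (suc j) = δ i j

  δ-refl : ∀ {n} (i : Fin n) → δ i i ≈ 1#
  δ-refl zero    = refl
  δ-refl (suc i) = δ-refl i

  δ-≢ : ∀ {n} {i j : Fin n} → i ≢ j → δ i j ≈ 0#
  δ-≢ {i = zero}  {zero}  i≢j = contradiction ≡.refl i≢j
  δ-≢ {i = zero}  {suc j} i≢j = refl
  δ-≢ {i = suc i} {zero}  i≢j = refl
  δ-≢ {i = suc i} {suc j} i≢j = δ-≢ (i≢j ∘ ≡.cong suc)

  sum-δ : ∀ {n} (f : Vector Carrier n) j → sum (λ i → f i * δ i j) ≈ f j
  sum-δ f zero    = trans
    (+-cong (*-identityʳ (f zero)) (sum-zero _ λ i → zeroʳ (f (suc i)))) (+-identityʳ (f zero))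
  sum-δ f (suc j) = trans (+-cong (zeroʳ (f zero)) (sum-δ (f ∘ suc) j)) (+-identityˡ (f (suc j)))

  sum-δ′ : ∀ {n} (f : Vector Carrier n) j → sum (λ i → δ j i * f i) ≈ f j
  sum-δ′ f zero    = trans
    (+-cong (*-identityˡ (f zero)) (sum-zero _ λ i → zeroˡ (f (suc i)))) (+-identityʳ (f zero))
  sum-δ′ f (suc j) = trans (+-cong (zeroˡ (f zero)) (sum-δ′ (f ∘ suc) j)) (+-identityˡ (f (suc j)))

  -- Associativity of the product of a row, a matrix and a column.
  sum-comm-* : ∀ {m n} (a : Vector Carrier m) (B : Fin m → Fin n → Carrier) (b : Vector Carrier n) →
    sum (λ j → sum (λ i → a i * B i j) * b j) ≈ sum (λ i → a i * sum (λ j → B i j * b j))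
  sum-comm-* a B b = begin
    sum (λ j → sum (λ i → a i * B i j) * b j)  ≈⟨ sum-cong-≋ (λ j → *-distribʳ-sum (b j) (λ i → a i * B i j)) ⟩
    sum (λ j → sum (λ i → a i * B i j * b j))  ≈⟨ ∑-comm (λ j i → a i * B i j * b j) ⟩
    sum (λ i → sum (λ j → a i * B i j * b j))  ≈⟨ sum-cong-≋ (λ i → sum-cong-≋ λ j → *-assoc (a i) (B i j) (b j)) ⟩
    sum (λ i → sum (λ j → a i * (B i j * b j))) ≈⟨ sum-cong-≋ (λ i → *-distribˡ-sum (a i) (λ j → B i j * b j)) ⟨
    sum (λ i → a i * sum (λ j → B i j * b j))  ∎

  -- Linear algebra

  NontrivialRelation : ∀ {m n} → (Fin m → Fin n → Carrier) → Set (c ⊔ ℓ₁ ⊔ ℓ₂)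
  NontrivialRelation {m} A = Σ[ w ∈ Vector Carrier m ]
    ((∃[ i ] w i # 0#) × (∀ k → combination w A k ≈ 0#))

  -- Gaussian elimination: `B` is `A` without the pivot row `p` and with the first column cleared,
  -- and the recursion treats its other columns. Without a pivot the first column is zero and the
  -- first row gets coefficient 0. The distinction is available only under a double negation.
  nontrivialRelation : ∀ n (A : Fin (suc n) → Fin n → Carrier) → ¬ ¬ NontrivialRelation A
  nontrivialRelation zero    A = pure ((λ _ → 1#) , (zero , 1#0) , λ ())
  nontrivialRelation (suc n) A = ¬¬-excluded-middle {A = ∃[ p ] A p zero # 0#} >>= λ
    { (yes (p , Ap0#0)) → pivot p Ap0#0
    ; (no ¬pivot)       → noPivot λ i → proj₁ (tight _ _) λ Ai0#0 → ¬pivot (i , Ai0#0) }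
    where
    noPivot : (∀ i → A i zero ≈ 0#) → ¬ ¬ NontrivialRelation A
    noPivot A0≈0 = do
      w , (i , wi#0) , eq ← nontrivialRelation n (λ i k → A (suc i) (suc k))
      let w′ = 0# Vector.∷ w
      pure (w′ , (suc i , wi#0) , λ
        { zero    → sum-zero (λ j → w′ j * A j zero) λ j → trans (*-congˡ (A0≈0 j)) (zeroʳ (w′ j))
        ; (suc k) → trans (+-cong (zeroˡ (A zero (suc k))) (eq k)) (+-identityˡ 0#) })

    pivot : ∀ p → A p zero # 0# → ¬ ¬ NontrivialRelation A
    pivot p Ap0#0 = do
      w , (i , wi#0) , eq ← nontrivialRelation n (λ i k → B i (suc k))
      -- `m` totals the multiples of row `p` that were added to the other rows.
      let m  = sum (λ i → w i * a i)
          w′ = Vector.insertAt w p m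
          relation : ∀ k → sum (λ j → w′ j * A j k) ≈ sum (λ i → w i * B i k)
          relation k = begin
            sum (λ j → w′ j * A j k)
              ≈⟨ sum-remove (λ j → w′ j * A j k) ⟩
            w′ p * A p k + sum (λ i → w′ (punchIn p i) * A (punchIn p i) k)
              ≈⟨ +-cong (reflexive (≡.cong (_* A p k) (Vector.insertAt-lookup w p m)))
                   (sum-cong-≋ λ i → reflexive (≡.cong (_* A (punchIn p i) k) (Vector.insertAt-punchIn w p m i))) ⟩
            m * A p k + sum (λ i → w i * A (punchIn p i) k)
              ≈⟨ +-congʳ (*-distribʳ-sum (A p k) (λ i → w i * a i)) ⟩
            sum (λ i → w i * a i * A p k) + sum (λ i → w i * A (punchIn p i) k)
              ≈⟨ ∑-distrib-+ (λ i → w i * a i * A p k) (λ i → w i * A (punchIn p i) k) ⟨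
            sum (λ i → w i * a i * A p k + w i * A (punchIn p i) k)
              ≈⟨ sum-cong-≋ (λ i → trans (+-congʳ (*-assoc (w i) (a i) (A p k))) (sym (distribˡ (w i) (a i * A p k) (A (punchIn p i) k)))) ⟩
            sum (λ i → w i * B i k) ∎
      pure (w′ , (punchIn p i , #-congʳ (reflexive (≡.sym (Vector.insertAt-punchIn w p m i))) wi#0) , λ
        { zero    → trans (relation zero) (sum-zero (λ i → w i * B i zero) λ i → trans (*-congˡ (B0≈0 i)) (zeroʳ (w i)))
        ; (suc k) → trans (relation (suc k)) (eq k) })
      where
      u = proj₁ (inverse Ap0#0)
      a : Fin (suc n) → Carrier
      a i = - (A (punchIn p i) zero * u)
      B : Fin (suc n) → Fin (suc n) → Carrier
      B i k = a i * A p k + A (punchIn p i) k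
      B0≈0 : ∀ i → B i zero ≈ 0#
      B0≈0 i = trans (+-congʳ (trans (sym (-‿distribˡ-* _ _)) (-‿cong
        (trans (*-assoc _ u _) (trans (*-congˡ (proj₂ (inverse Ap0#0))) (*-identityʳ _)))))) (-‿inverseˡ _)

  combination-linear : ∀ {m n} (w w′ : Vector Carrier m) a (P : Fin m → Vector Carrier n) k →
    combination (λ i → w i + a * w′ i) P k ≈ combination w P k + a * combination w′ P k
  combination-linear w w′ a P k = begin
    sum (λ i → (w i + a * w′ i) * P i k)
      ≈⟨ sum-cong-≋ (λ i → trans (distribʳ (P i k) (w i) (a * w′ i)) (+-congˡ (*-assoc a (w′ i) (P i k)))) ⟩
    sum (λ i → w i * P i k + a * (w′ i * P i k))
      ≈⟨ ∑-distrib-+ (λ i → w i * P i k) (λ i → a * (w′ i * P i k)) ⟩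
    combination w P k + sum (λ i → a * (w′ i * P i k))
      ≈⟨ +-congˡ (*-distribˡ-sum a (λ i → w′ i * P i k)) ⟨
    combination w P k + a * combination w′ P k ∎

  combination-* : ∀ {m n} a (w : Vector Carrier m) (P : Fin m → Vector Carrier n) k →
    combination (λ i → a * w i) P k ≈ a * combination w P k
  combination-* a w P k = trans (sum-cong-≋ λ i → *-assoc a (w i) (P i k))
    (sym (*-distribˡ-sum a (λ i → w i * P i k)))

  LinearlyIndependent : ∀ {m n} → (Fin m → Vector Carrier n) → Set (c ⊔ ℓ₁)
  LinearlyIndependent P = ∀ w → (∀ k → combination w P k ≈ 0#) → ∀ i → w i ≈ 0#

  Span : ∀ {m n} → (Fin m → Vector Carrier n) → Vector Carrier n → Set (c ⊔ ℓ₁)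
  Span {m} P X = Σ[ w ∈ Vector Carrier m ] (∀ k → combination w P k ≈ X k)

  independent-unique : ∀ {m n} {P : Fin m → Vector Carrier n} → LinearlyIndependent P →
    ∀ w w′ → (∀ k → combination w P k ≈ combination w′ P k) → ∀ i → w i ≈ w′ i
  independent-unique {P = P} independent w w′ eq i = begin
    w i                             ≈⟨ +-identityʳ (w i) ⟨
    w i + 0#                        ≈⟨ +-congˡ (-‿inverseˡ (w′ i)) ⟨
    w i + (- w′ i + w′ i)           ≈⟨ +-assoc (w i) (- w′ i) (w′ i) ⟨
    w i + - w′ i + w′ i             ≈⟨ +-congʳ (+-congˡ (-1*x≈-x (w′ i))) ⟨
    w i + (- 1#) * w′ i + w′ i      ≈⟨ +-congʳ (independent (λ i → w i + (- 1#) * w′ i) vanish i) ⟩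
    0# + w′ i                       ≈⟨ +-identityˡ (w′ i) ⟩
    w′ i                            ∎
    where
    vanish : ∀ k → combination (λ i → w i + (- 1#) * w′ i) P k ≈ 0#
    vanish k = begin
      combination (λ i → w i + (- 1#) * w′ i) P k           ≈⟨ combination-linear w w′ (- 1#) P k ⟩
      combination w P k + (- 1#) * combination w′ P k       ≈⟨ +-cong (eq k) (-1*x≈-x _) ⟩
      combination w′ P k + - combination w′ P k             ≈⟨ -‿inverseʳ _ ⟩
      0#                                                    ∎

  -- `X` and `P` together satisfy a nontrivial relation. Its coefficient at `X` cannot vanish, since
  -- `P` would then be dependent; dividing by it expresses `X`.
  independent⇒spanning : ∀ {n} {P : Fin n → Vector Carrier n} → LinearlyIndependent P → ∀ X → ¬ ¬ Span P X
  independent⇒spanning {n} {P} independent X = do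
    w , (i , wi#0) , eq ← nontrivialRelation n (X Vector.∷ P)
    w₀-cases ← ¬¬-excluded-middle {A = w zero # 0#}
    solve w i wi#0 eq w₀-cases
    where
    solve : ∀ w i → w i # 0# → (∀ k → combination w (X Vector.∷ P) k ≈ 0#) → Dec (w zero # 0#) → ¬ ¬ Span P X
    solve w i wi#0 eq (yes w₀#0) = pure ((λ i → - v * w (suc i)) , λ k → begin
      combination (λ i → - v * w (suc i)) P k  ≈⟨ combination-* (- v) (w ∘ suc) P k ⟩
      - v * combination (w ∘ suc) P k          ≈⟨ -‿distribˡ-* v _ ⟨
      - (v * combination (w ∘ suc) P k)        ≈⟨ -‿distribʳ-* v _ ⟩
      v * - combination (w ∘ suc) P k          ≈⟨ *-congˡ (inverseˡ-unique (w zero * X k) _ (eq k)) ⟨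
      v * (w zero * X k)                       ≈⟨ *-assoc v (w zero) (X k) ⟨
      v * w zero * X k                         ≈⟨ *-congʳ (proj₂ (inverse w₀#0)) ⟩
      1# * X k                                 ≈⟨ *-identityˡ (X k) ⟩
      X k                                      ∎)
      where v = proj₁ (inverse w₀#0)
    solve w i wi#0 eq (no ¬w₀#0) = contradiction wi#0 λ wi#0 → #-irrefl (w≈0 i) wi#0
      where
      w₀≈0 : w zero ≈ 0#
      w₀≈0 = proj₁ (tight _ _) ¬w₀#0
      w≈0 : ∀ i → w i ≈ 0#
      w≈0 zero    = w₀≈0
      w≈0 (suc i) = independent (w ∘ suc) (λ k → begin
        combination (w ∘ suc) P k                   ≈⟨ +-identityˡ _ ⟨
        0# + combination (w ∘ suc) P k              ≈⟨ +-congʳ (trans (*-congʳ w₀≈0) (zeroˡ (X k))) ⟨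
        w zero * X k + combination (w ∘ suc) P k    ≈⟨ eq k ⟩
        0#                                          ∎) i

  -- Linear functionals and dual bases.

  ⟨_,_⟩ : ∀ {n} → Vector Carrier n → Vector Carrier n → Carrier
  ⟨ ℓ , X ⟩ = sum (λ k → X k * ℓ k)

  ⟨,⟩-cong : ∀ {n} (ℓ : Vector Carrier n) {X Y} → (∀ k → X k ≈ Y k) → ⟨ ℓ , X ⟩ ≈ ⟨ ℓ , Y ⟩
  ⟨,⟩-cong ℓ X≈Y = sum-cong-≋ λ k → *-congʳ (X≈Y k)

  ⟨,⟩-combination : ∀ {m n} (ℓ : Vector Carrier n) (w : Vector Carrier m) (P : Fin m → Vector Carrier n) →
    ⟨ ℓ , combination w P ⟩ ≈ sum (λ i → w i * ⟨ ℓ , P i ⟩)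
  ⟨,⟩-combination ℓ w P = sum-comm-* w P ℓ

  ⟨,⟩-linear : ∀ {n} (ℓ : Vector Carrier n) K X Y → ⟨ ℓ , (λ k → K * X k + Y k) ⟩ ≈ K * ⟨ ℓ , X ⟩ + ⟨ ℓ , Y ⟩
  ⟨,⟩-linear ℓ K X Y = begin
    sum (λ k → (K * X k + Y k) * ℓ k)
      ≈⟨ sum-cong-≋ (λ k → trans (distribʳ (ℓ k) (K * X k) (Y k)) (+-congʳ (*-assoc K (X k) (ℓ k)))) ⟩
    sum (λ k → K * (X k * ℓ k) + Y k * ℓ k)
      ≈⟨ ∑-distrib-+ (λ k → K * (X k * ℓ k)) (λ k → Y k * ℓ k) ⟩
    sum (λ k → K * (X k * ℓ k)) + ⟨ ℓ , Y ⟩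
      ≈⟨ +-congʳ (*-distribˡ-sum K (λ k → X k * ℓ k)) ⟨
    K * ⟨ ℓ , X ⟩ + ⟨ ℓ , Y ⟩ ∎

  -- `dual` and `expand` say that the matrix `Λ` inverts `P` on either side. For a simplex in
  -- homogeneous coordinates the `Λ i` are the barycentric coordinates, and the zero set of `Λ i` is
  -- the hyperplane of the facet opposite to vertex `i`.
  record DualBasis {n} (P : Fin n → Vector Carrier n) : Set (c ⊔ ℓ₁) where
    field
      Λ      : Fin n → Vector Carrier n
      dual   : ∀ i j → ⟨ Λ i , P j ⟩ ≈ δ j i
      expand : ∀ X k → combination (λ i → ⟨ Λ i , X ⟩) P k ≈ X k

    coordinate : ∀ i w → ⟨ Λ i , combination w P ⟩ ≈ w i
    coordinate i w = trans (⟨,⟩-combination (Λ i) w P)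
      (trans (sum-cong-≋ λ j → *-congˡ (dual i j)) (sum-δ w i))

    dual-refl : ∀ i → ⟨ Λ i , P i ⟩ ≈ 1#
    dual-refl i = trans (dual i i) (δ-refl i)

    dual-≢ : ∀ {i j} → i ≢ j → ⟨ Λ i , P j ⟩ ≈ 0#
    dual-≢ {i} {j} i≢j = trans (dual i j) (δ-≢ (i≢j ∘ ≡.sym))

  -- The coordinates of the unit vectors with respect to `P` form the inverse matrix; `dual` follows
  -- because the coordinates of `P j` are unique.
  dualBasis : ∀ {n} {P : Fin n → Vector Carrier n} → LinearlyIndependent P → ¬ ¬ DualBasis P
  dualBasis {n} {P} independent = do
    units ← ¬¬-all λ k → independent⇒spanning independent (δ k)
    let C : Fin n → Vector Carrier n
        C k = proj₁ (units k)
        Λ = λ i k → C k i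
        expand : ∀ X k → combination (λ i → ⟨ Λ i , X ⟩) P k ≈ X k
        expand X k = trans (sum-comm-* X C (λ i → P i k))
          (trans (sum-cong-≋ λ j → *-congˡ (proj₂ (units j) k)) (sum-δ X k))
    pure record
      { Λ      = Λ
      ; dual   = λ i j → independent-unique independent (λ i → ⟨ Λ i , P j ⟩) (δ j)
                   (λ k → trans (expand (P j) k) (sym (sum-δ′ (λ i → P i k) j))) i
      ; expand = expand
      }

  -- The functional `ℓ′` separates `e` from the span of `Q`, so `e` completes `Q` to a basis, and
  -- the two sides agree on that basis.
  vanishing⇒proportional : ∀ {n} {Q : Fin n → Vector Carrier (suc n)} → LinearlyIndependent Q →
    ∀ (ℓ ℓ′ e : Vector Carrier (suc n)) → (∀ k → ⟨ ℓ , Q k ⟩ ≈ 0#) → (∀ k → ⟨ ℓ′ , Q k ⟩ ≈ 0#) → ⟨ ℓ′ , e ⟩ ≈ 1# →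
    ∀ X → ⟨ ℓ , X ⟩ ≈ ⟨ ℓ , e ⟩ * ⟨ ℓ′ , X ⟩
  vanishing⇒proportional {n} {Q} independent ℓ ℓ′ e ℓQ≈0 ℓ′Q≈0 ℓ′e≈1 X =
    ≈-stable (independent⇒spanning {P = e Vector.∷ Q} basis X >>= λ { (w , eq) → pure (proportional w eq) })
    where
    evaluate : ∀ (ℓ : Vector Carrier (suc n)) → (∀ k → ⟨ ℓ , Q k ⟩ ≈ 0#) → ∀ w →
      ⟨ ℓ , combination w (e Vector.∷ Q) ⟩ ≈ w zero * ⟨ ℓ , e ⟩
    evaluate ℓ ℓQ≈0 w = trans (⟨,⟩-combination ℓ w (e Vector.∷ Q))
      (trans (+-congˡ (sum-zero _ λ k → trans (*-congˡ (ℓQ≈0 k)) (zeroʳ (w (suc k))))) (+-identityʳ _))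

    leading : ∀ w → ⟨ ℓ′ , combination w (e Vector.∷ Q) ⟩ ≈ w zero
    leading w = trans (evaluate ℓ′ ℓ′Q≈0 w) (trans (*-congˡ ℓ′e≈1) (*-identityʳ (w zero)))

    basis : LinearlyIndependent (e Vector.∷ Q)
    basis w eq = λ { zero → w₀≈0 ; (suc i) → independent (w ∘ suc) (λ k → begin
        combination (w ∘ suc) Q k                   ≈⟨ +-identityˡ _ ⟨
        0# + combination (w ∘ suc) Q k              ≈⟨ +-congʳ (trans (*-congʳ w₀≈0) (zeroˡ (e k))) ⟨
        w zero * e k + combination (w ∘ suc) Q k    ≈⟨ eq k ⟩
        0#                                          ∎) i }
      where
      w₀≈0 : w zero ≈ 0#
      w₀≈0 = trans (sym (leading w))
        (trans (⟨,⟩-cong ℓ′ eq) (sum-zero _ λ k → zeroˡ (ℓ′ k)))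

    proportional : ∀ w → (∀ k → combination w (e Vector.∷ Q) k ≈ X k) → ⟨ ℓ , X ⟩ ≈ ⟨ ℓ , e ⟩ * ⟨ ℓ′ , X ⟩
    proportional w eq = begin
      ⟨ ℓ , X ⟩                                            ≈⟨ ⟨,⟩-cong ℓ eq ⟨
      ⟨ ℓ , combination w (e Vector.∷ Q) ⟩                  ≈⟨ evaluate ℓ ℓQ≈0 w ⟩
      w zero * ⟨ ℓ , e ⟩                                    ≈⟨ *-comm _ _ ⟩
      ⟨ ℓ , e ⟩ * w zero                                    ≈⟨ *-congˡ (leading w) ⟨
      ⟨ ℓ , e ⟩ * ⟨ ℓ′ , combination w (e Vector.∷ Q) ⟩     ≈⟨ *-congˡ (⟨,⟩-cong ℓ′ eq) ⟩
      ⟨ ℓ , e ⟩ * ⟨ ℓ′ , X ⟩                                ∎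

  -- Strict inequalities for large parameters.

  Eventually : ∀ {p} → (Carrier → Set p) → Set (c ⊔ ℓ₂ ⊔ p)
  Eventually P = Σ[ K ∈ Carrier ] (0# < K × (∀ {K′} → K < K′ → P K′))

  x<x+y : ∀ x {y} → 0# < y → x < x + y
  x<x+y x {y} y>0 = <-respˡ (+-identityˡ x) (<-respʳ (+-comm y x) (+-monoˡ-< x y>0))

  eventually-× : ∀ {p q} {P : Carrier → Set p} {Q : Carrier → Set q} →
    Eventually P → Eventually Q → Eventually (λ K → P K × Q K)
  eventually-× (K , K>0 , p) (L , L>0 , q) = K + L , pos-+ K>0 L>0 , λ K+L<M →
    p (<-trans (x<x+y K L>0) K+L<M) , q (<-trans (<-respʳ (+-comm L K) (x<x+y L K>0)) K+L<M)

  eventually-all : ∀ {n p} {P : Fin n → Carrier → Set p} →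
    (∀ i → Eventually (P i)) → Eventually (λ K → ∀ i → P i K)
  eventually-all {zero}  ev = 1# , 0<1 , λ _ ()
  eventually-all {suc n} ev with eventually-× (ev zero) (eventually-all (ev ∘ suc))
  ... | K , K>0 , p = K , K>0 , λ K<M → λ { zero → proj₁ (p K<M) ; (suc i) → proj₂ (p K<M) i }

  eventually⇒∃ : ∀ {p} {P : Carrier → Set p} → Eventually P → Σ[ K ∈ Carrier ] (0# < K × P K)
  eventually⇒∃ (K , K>0 , p) = K + 1# , pos-+ K>0 0<1 , p (x<x+y K 0<1)

  -- The threshold is b / α, where `b` is a positive number above - β obtained from the Archimedean
  -- axiom. Beyond it K α + β exceeds b + β, which is positive.
  eventually-positive : ∀ {α β} → 0# < α → Eventually (λ K → 0# < K * α + β)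
  eventually-positive {α} {β} α>0 = b * v , *-pos b>0 v>0 , λ {K} bv<K → <-respʳ (regroup K)
      (pos-+ (*-pos (<-respˡ (-‿inverseʳ (b * v)) (+-monoˡ-< (- (b * v)) bv<K)) α>0) b+β>0)
    where
    v = proj₁ (inverse (>0⇒#0 α>0))
    vα≈1 : v * α ≈ 1#
    vα≈1 = proj₂ (inverse (>0⇒#0 α>0))
    v>0 : 0# < v
    v>0 = HasSign-inverse false (trans (*-comm α v) vα≈1) α>0
    ·1-nonNeg : ∀ n → 0# < 1# + n · 1#
    ·1-nonNeg zero    = <-respʳ (sym (+-identityʳ 1#)) 0<1
    ·1-nonNeg (suc n) = pos-+ 0<1 (·1-nonNeg n)
    n = proj₁ (archimedean (- β))
    b = 1# + n · 1#
    b>0 : 0# < b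
    b>0 = ·1-nonNeg n
    -β<b : - β < b
    -β<b = <-trans (proj₂ (archimedean (- β))) (<-respʳ (+-comm (n · 1#) 1#) (x<x+y (n · 1#) 0<1))
    b+β>0 : 0# < b + β
    b+β>0 = <-respˡ (-‿inverseˡ β) (+-monoˡ-< β -β<b)
    regroup : ∀ K → (K - b * v) * α + (b + β) ≈ K * α + β
    regroup K = begin
      (K - b * v) * α + (b + β)            ≈⟨ +-congˡ (+-congʳ (trans (*-assoc b v α) (trans (*-congˡ vα≈1) (*-identityʳ b)))) ⟨
      (K - b * v) * α + (b * v * α + β)    ≈⟨ +-assoc _ _ β ⟨
      (K - b * v) * α + b * v * α + β      ≈⟨ +-congʳ (distribʳ α (K - b * v) (b * v)) ⟨
      (K - b * v + b * v) * α + β          ≈⟨ +-congʳ (*-congʳ (trans (+-assoc K _ _) (trans (+-congˡ (-‿inverseˡ (b * v))) (+-identityʳ K)))) ⟩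
      K * α + β                            ∎

  -- Openness of a strict inequality: in homogeneous coordinates a large multiple of `X` plus `e` is
  -- a small perturbation of `X`.
  eventually-positive-linear : ∀ {n} (ℓ X e : Vector Carrier n) → 0# < ⟨ ℓ , X ⟩ →
    Eventually (λ K → 0# < ⟨ ℓ , (λ k → K * X k + e k) ⟩)
  eventually-positive-linear ℓ X e ℓX>0 = let K , K>0 , p = eventually-positive ℓX>0 in
    K , K>0 , λ {L} K<L → <-respʳ (sym (⟨,⟩-linear ℓ L X e)) (p K<L)

  span-difference : ∀ {m n} {P : Fin m → Vector Carrier n} K X e →
    Span P X → Span P (λ k → K * X k + e k) → Span P e
  span-difference {P = P} K X e (w , eq) (w′ , eq′) = (λ j → w′ j + - K * w j) , λ k → begin
    combination (λ j → w′ j + - K * w j) P k       ≈⟨ combination-linear w′ w (- K) P k ⟩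
    combination w′ P k + - K * combination w P k   ≈⟨ +-cong (eq′ k) (*-congˡ (eq k)) ⟩
    K * X k + e k + - K * X k                      ≈⟨ +-cong (+-comm (K * X k) (e k)) (sym (-‿distribˡ-* K (X k))) ⟩
    e k + K * X k + - (K * X k)                    ≈⟨ +-assoc (e k) _ _ ⟩
    e k + (K * X k + - (K * X k))                  ≈⟨ +-congˡ (-‿inverseʳ (K * X k)) ⟩
    e k + 0#                                       ≈⟨ +-identityʳ (e k) ⟩
    e k                                            ∎

  Proportional : ∀ {n} → Bool → Vector Carrier n → Vector Carrier n → Set (c ⊔ ℓ₁ ⊔ ℓ₂)
  Proportional b ℓ ℓ′ = Σ[ a ∈ Carrier ] (HasSign b a × (∀ X → ⟨ ℓ , X ⟩ ≈ a * ⟨ ℓ′ , X ⟩))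

  -- Simplices in homogeneous coordinates

  hat : ∀ {d} → Point d → Vector Carrier (suc d)
  hat x = 1# Vector.∷ x

  sum-*1 : ∀ {m} (w : Vector Carrier m) → sum (λ i → w i * 1#) ≈ sum w
  sum-*1 w = sum-cong-≋ λ i → *-identityʳ (w i)

  hat-combination : ∀ {d m} (w : Vector Carrier m) (p : Vector (Point d) m) {x} →
    sum w ≈ 1# → (∀ k → combination w p k ≈ x k) → ∀ k → combination w (hat ∘ p) k ≈ hat x k
  hat-combination w p sum≈1 eq zero    = trans (sum-*1 w) sum≈1
  hat-combination w p sum≈1 eq (suc k) = eq k

  hat-independent : ∀ {d m} {p : Vector (Point d) m} → AffinelyIndependent p → LinearlyIndependent (hat ∘ p)
  hat-independent independent w eq =
    independent w (trans (sym (sum-*1 w)) (eq zero)) (λ k → eq (suc k))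

  homogeneousVertices : ∀ {d} → Simplex d → Fin (suc d) → Vector Carrier (suc d)
  homogeneousVertices σ = hat ∘ Simplex.vertices σ

  Barycentric : ∀ {d} → Simplex d → Set (c ⊔ ℓ₁)
  Barycentric σ = DualBasis (homogeneousVertices σ)

  barycentric : ∀ {d} (σ : Simplex d) → ¬ ¬ Barycentric σ
  barycentric σ = dualBasis (hat-independent {p = Simplex.vertices σ} (Simplex.independent σ))

  module _ {d} (σ : Simplex d) (B : Barycentric σ) where
    open DualBasis B

    sum-coordinates : ∀ X → sum (λ i → ⟨ Λ i , X ⟩) ≈ X zero
    sum-coordinates X = trans (sym (sum-*1 (λ i → ⟨ Λ i , X ⟩))) (expand X zero)

    hull-nonNeg : ∀ {x} → ⟦ σ ⟧ x → ∀ i → NonNeg ⟨ Λ i , hat x ⟩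
    hull-nonNeg (w , w≥0 , sum≈1 , eq) i λ<0 = w≥0 i (<-respˡ
      (trans (⟨,⟩-cong (Λ i) λ k → sym (hat-combination w (Simplex.vertices σ) sum≈1 eq k)) (coordinate i w)) λ<0)

    -- Multiplication by `v`, the inverse of the first entry, brings `z` into the affine chart of
    -- the vectors `hat x`.
    interior⇒hull : ∀ z v → v * z zero ≈ 1# → 0# < v → (∀ i → 0# < ⟨ Λ i , z ⟩) → ⟦ σ ⟧ (λ k → v * z (suc k))
    interior⇒hull z v vz≈1 v>0 z>0 = (λ i → v * ⟨ Λ i , z ⟩) ,
      (λ i vλ<0 → <-irrefl refl (<-trans (*-pos v>0 (z>0 i)) vλ<0)) ,
      trans (sym (*-distribˡ-sum v (λ i → ⟨ Λ i , z ⟩))) (trans (*-congˡ (sum-coordinates z)) vz≈1) ,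
      λ k → trans (combination-* v (λ i → ⟨ Λ i , z ⟩) (homogeneousVertices σ) (suc k)) (*-congˡ (expand z (suc k)))

  -- Contact of two neighborly simplices along a common facet hyperplane.

  module Contact {d} {σ τ : Simplex (suc d)} (A : Barycentric σ) (B : Barycentric τ) (σ∩τ : Neighborly σ τ) where
    private
      module A = DualBasis A
      module B = DualBasis B

      q = proj₁ σ∩τ
      Q = hat ∘ q
      hull⊆span = proj₁ (proj₂ (proj₂ σ∩τ))
      span⊆hull = proj₂ (proj₂ (proj₂ σ∩τ))

      Q-independent : LinearlyIndependent Q
      Q-independent = hat-independent {p = q} (proj₁ (proj₂ σ∩τ))

    CommonInterior : Vector Carrier (suc (suc d)) → Set ℓ₂
    CommonInterior z = (∀ i → 0# < ⟨ A.Λ i , z ⟩) × (∀ j → 0# < ⟨ B.Λ j , z ⟩)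

    commonInterior⇒Span : ∀ z → CommonInterior z → Span Q z
    commonInterior⇒Span z (σz>0 , τz>0) =
      let w , sum≈1 , eq = hull⊆span inHull
      in (λ k → z zero * w k) , λ
        { zero    → trans (combination-* (z zero) w Q zero)
            (trans (*-congˡ (hat-combination w q sum≈1 eq zero)) (*-identityʳ (z zero)))
        ; (suc k) → trans (combination-* (z zero) w Q (suc k)) (trans (*-congˡ (eq k))
            (trans (sym (*-assoc (z zero) v (z (suc k)))) (trans (*-congʳ (trans (*-comm (z zero) v) vz≈1))
              (*-identityˡ (z (suc k)))))) }
      where
      z₀>0 : 0# < z zero
      z₀>0 = <-respʳ (sum-coordinates σ A z) (sum-pos (λ i → ⟨ A.Λ i , z ⟩) σz>0)
      v = proj₁ (inverse (>0⇒#0 z₀>0))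
      vz≈1 : v * z zero ≈ 1#
      vz≈1 = proj₂ (inverse (>0⇒#0 z₀>0))
      v>0 : 0# < v
      v>0 = HasSign-inverse false (trans (*-comm (z zero) v) vz≈1) z₀>0
      y : Point (suc d)
      y k = v * z (suc k)
      -- A point of the intersection lies in its affine hull as a combination of one point.
      inHull = 1 , (λ _ → y) ,
        (λ _ → interior⇒hull σ A z v vz≈1 v>0 σz>0 , interior⇒hull τ B z v vz≈1 v>0 τz>0) ,
        (λ _ → 1#) , +-identityʳ 1# , λ k → trans (+-identityʳ _) (*-identityˡ (y k))

    -- A common interior point would put all the vertices of σ into the span of
    -- one vector too few.
    noCommonInterior : ∀ z → ¬ CommonInterior z
    noCommonInterior z (σz>0 , τz>0) = nontrivialRelation (suc d) W λ { (w , (i , wi#0) , eq) →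
        #-irrefl (hat-independent {p = Simplex.vertices σ} (Simplex.independent σ) w (λ k → begin
          combination w (homogeneousVertices σ) k
            ≈⟨ sum-cong-≋ (λ i → *-congˡ {w i} (proj₂ (vertexInSpan i) k)) ⟨
          sum (λ i → w i * combination (W i) Q k)
            ≈⟨ sum-comm-* w W (λ j → Q j k) ⟨
          sum (λ j → combination w W j * Q j k)
            ≈⟨ sum-zero _ (λ j → trans (*-congʳ (eq j)) (zeroˡ (Q j k))) ⟩
          0# ∎) i) wi#0 }
      where
      -- The common interior is open, so it contains, besides `z`, a large multiple of `z` plus any
      -- given `e`. Both lie in the span of `Q`, hence so does `e`.
      shifted : ∀ e → Σ[ K ∈ Carrier ] (0# < K × CommonInterior (λ k → K * z k + e k))
      shifted e = eventually⇒∃ (eventually-×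
        (eventually-all λ j → eventually-positive-linear (A.Λ j) z e (σz>0 j))
        (eventually-all λ j → eventually-positive-linear (B.Λ j) z e (τz>0 j)))
      everythingInSpan : ∀ e → Span Q e
      everythingInSpan e = span-difference {P = Q} (proj₁ (shifted e)) z e
        (commonInterior⇒Span z (σz>0 , τz>0))
        (commonInterior⇒Span (λ k → proj₁ (shifted e) * z k + e k) (proj₂ (proj₂ (shifted e))))
      vertexInSpan : ∀ i → Span Q (homogeneousVertices σ i)
      vertexInSpan i = everythingInSpan (homogeneousVertices σ i)
      W : Fin (suc (suc d)) → Vector Carrier (suc d)
      W i = proj₁ (vertexInSpan i)

    private
      -- The coefficients `δ k` place `q k` in the affine span of `q`. Membership in the affine hull
      -- then supplies the points of the intersection from which `centre` is built.
      inAffineHull : ∀ k → affineHull (λ x → ⟦ σ ⟧ x × ⟦ τ ⟧ x) (q k)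
      inAffineHull k = span⊆hull (δ k ,
        trans (sym (sum-*1 (δ k))) (sum-δ′ (λ _ → 1#) k) , λ l → sum-δ′ (λ i → q i l) k)

      size : Fin (suc d) → ℕ
      size k = proj₁ (inAffineHull k)
      point : ∀ k → Fin (size k) → Point (suc d)
      point k = proj₁ (proj₂ (inAffineHull k))
      point∈ : ∀ k j → ⟦ σ ⟧ (point k j) × ⟦ τ ⟧ (point k j)
      point∈ k = proj₁ (proj₂ (proj₂ (inAffineHull k)))

    -- A positive multiple of a point in the relative interior of σ ∩ τ.
    centre : Vector Carrier (suc (suc d))
    centre = combination (λ _ → 1#) (λ k → combination (λ _ → 1#) (hat ∘ point k))

    private
      ⟨,⟩-centre : ∀ ℓ → ⟨ ℓ , centre ⟩ ≈ sum (λ k → sum (λ j → ⟨ ℓ , hat (point k j) ⟩))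
      ⟨,⟩-centre ℓ = trans (⟨,⟩-combination ℓ (λ _ → 1#) (λ k → combination (λ _ → 1#) (hat ∘ point k)))
        (sum-cong-≋ λ k → trans (*-identityˡ ⟨ ℓ , combination (λ _ → 1#) (hat ∘ point k) ⟩)
          (trans (⟨,⟩-combination ℓ (λ _ → 1#) (hat ∘ point k))
            (sum-cong-≋ λ j → *-identityˡ ⟨ ℓ , hat (point k j) ⟩)))

    module _ (ℓ : Vector Carrier (suc (suc d))) (ℓ≥0 : ∀ k j → NonNeg ⟨ ℓ , hat (point k j) ⟩) where

      centre-nonNeg : NonNeg ⟨ ℓ , centre ⟩
      centre-nonNeg ℓ<0 = sum-nonNeg _ (λ k → sum-nonNeg _ (ℓ≥0 k)) (<-respˡ (⟨,⟩-centre ℓ) ℓ<0)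

      -- A sum of nonnegative terms vanishes only termwise, so `ℓ` is zero at all the chosen points
      -- and therefore at their affine combinations `q k`.
      centre-vanish : ⟨ ℓ , centre ⟩ ≈ 0# → ∀ k → ⟨ ℓ , Q k ⟩ ≈ 0#
      centre-vanish ℓ≈0 k =
        let w , sum≈1 , eq = proj₂ (proj₂ (proj₂ (inAffineHull k)))
            points≈0 = sum-nonNeg≈0 _ (ℓ≥0 k) (sum-nonNeg≈0 _ (λ k → sum-nonNeg _ (ℓ≥0 k))
              (trans (sym (⟨,⟩-centre ℓ)) ℓ≈0) k)
        in trans (⟨,⟩-cong ℓ λ l → sym (hat-combination w (point k) sum≈1 eq l))
             (trans (⟨,⟩-combination ℓ w (hat ∘ point k))
               (sum-zero _ λ j → trans (*-congˡ (points≈0 j)) (zeroʳ (w j))))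

    private
      σ≥0 : ∀ i k j → NonNeg ⟨ A.Λ i , hat (point k j) ⟩
      σ≥0 i k j = hull-nonNeg σ A (proj₁ (point∈ k j)) i
      τ≥0 : ∀ i k j → NonNeg ⟨ B.Λ i , hat (point k j) ⟩
      τ≥0 i k j = hull-nonNeg τ B (proj₂ (point∈ k j)) i

    -- Lexicographic positivity, first at `centre` and then at `e`: it expresses that `ℓ` is
    -- positive after a slight move from the centre towards `e`.
    PositiveTowards : Vector Carrier (suc (suc d)) → Vector Carrier (suc (suc d)) → Set (ℓ₁ ⊔ ℓ₂)
    PositiveTowards e ℓ = 0# < ⟨ ℓ , centre ⟩ ⊎ (⟨ ℓ , centre ⟩ ≈ 0# × 0# < ⟨ ℓ , e ⟩)

    -- For large K the vector K `centre` + `e` would be interior to both simplices.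
    noCommonDirection : ∀ e → (∀ i → PositiveTowards e (A.Λ i)) → ¬ (∀ j → PositiveTowards e (B.Λ j))
    noCommonDirection e σe τe =
      let K , K>0 , σ>0 , τ>0 = eventually⇒∃ (eventually-×
            (eventually-all λ i → eventually (A.Λ i) (σe i)) (eventually-all λ j → eventually (B.Λ j) (τe j)))
      in noCommonInterior (λ k → K * centre k + e k) (σ>0 , τ>0)
      where
      eventually : ∀ ℓ → PositiveTowards e ℓ → Eventually (λ K → 0# < ⟨ ℓ , (λ k → K * centre k + e k) ⟩)
      eventually ℓ (inj₁ ℓ>0)          = eventually-positive-linear ℓ centre e ℓ>0
      eventually ℓ (inj₂ (ℓ≈0 , ℓe>0)) = 1# , 0<1 , λ {L} _ → <-respʳ
        (trans (sym (trans (+-congʳ (trans (*-congˡ ℓ≈0) (zeroʳ L))) (+-identityˡ ⟨ ℓ , e ⟩))) (sym (⟨,⟩-linear ℓ L centre e))) ℓe>0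

    -- Both functionals would be multiples of each other by `vanishing⇒proportional`, which the
    -- values of a dual basis exclude.
    uniqueFacet : ∀ {P : Fin (suc (suc d)) → Vector Carrier (suc (suc d))} (C : DualBasis P) →
      ∀ {i i′} → i ≢ i′ → (∀ k → ⟨ DualBasis.Λ C i , Q k ⟩ ≈ 0#) → ¬ (∀ k → ⟨ DualBasis.Λ C i′ , Q k ⟩ ≈ 0#)
    uniqueFacet {P} C {i} {i′} i≢i′ ΛQ≈0 Λ′Q≈0 = 0≉1 (begin
      0#                                ≈⟨ zeroˡ ⟨ Λ i , P i′ ⟩ ⟨
      0# * ⟨ Λ i , P i′ ⟩               ≈⟨ *-congʳ (dual-≢ (i≢i′ ∘ ≡.sym)) ⟨
      ⟨ Λ i′ , P i ⟩ * ⟨ Λ i , P i′ ⟩   ≈⟨ vanishing⇒proportional {Q = Q} Q-independent (Λ i′) (Λ i) (P i)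
                                             Λ′Q≈0 ΛQ≈0 (dual-refl i) (P i′) ⟨
      ⟨ Λ i′ , P i′ ⟩                   ≈⟨ dual-refl i′ ⟩
      1#                                ∎)
      where open DualBasis C

    -- If no coordinate of one simplex vanished at `centre`, a slight move towards the barycentre of
    -- the other would reach both interiors. So each simplex has a facet functional vanishing on
    -- `Q`, and the two are proportional. A positive factor is impossible, since a move towards the
    -- vertex of τ off the common hyperplane would again reach both interiors.
    oppositeFacets : ¬ ¬ (∃[ i ] ∃[ j ] Proportional true (A.Λ i) (B.Λ j))
    oppositeFacets = do
      σ-cases ← ¬¬-all λ i → nonNeg-split (centre-nonNeg (A.Λ i) (σ≥0 i))
      τ-cases ← ¬¬-all λ j → nonNeg-split (centre-nonNeg (B.Λ j) (τ≥0 j))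
      decide σ-cases τ-cases (search σ-cases) (search τ-cases)
      where
      Cases : (Fin (suc (suc d)) → Vector Carrier (suc (suc d))) → Set (ℓ₁ ⊔ ℓ₂)
      Cases Λ = ∀ i → ⟨ Λ i , centre ⟩ ≈ 0# ⊎ 0# < ⟨ Λ i , centre ⟩

      SearchResult : (Fin (suc (suc d)) → Vector Carrier (suc (suc d))) → Set (ℓ₁ ⊔ ℓ₂)
      SearchResult Λ = (∃[ i ] ⟨ Λ i , centre ⟩ ≈ 0#) ⊎ (∀ i → 0# < ⟨ Λ i , centre ⟩)

      towards : ∀ Λ e → Cases Λ → (∀ i → ⟨ Λ i , centre ⟩ ≈ 0# → 0# < ⟨ Λ i , e ⟩) → ∀ i → PositiveTowards e (Λ i)
      towards Λ e cases e>0 i with cases i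
      ... | inj₁ ≈0 = inj₂ (≈0 , e>0 i ≈0)
      ... | inj₂ >0 = inj₁ >0

      barycentre : Simplex (suc d) → Vector Carrier (suc (suc d))
      barycentre ρ = combination (λ _ → 1#) (homogeneousVertices ρ)

      barycentre>0 : ∀ ρ (C : Barycentric ρ) i → 0# < ⟨ DualBasis.Λ C i , barycentre ρ ⟩
      barycentre>0 ρ C i = <-respʳ (sym (DualBasis.coordinate C i (λ _ → 1#))) 0<1

      decide : Cases A.Λ → Cases B.Λ → SearchResult A.Λ → SearchResult B.Λ →
        ¬ ¬ (∃[ i ] ∃[ j ] Proportional true (A.Λ i) (B.Λ j))
      decide σ-cases τ-cases (inj₂ σ>0) _ = λ _ → noCommonDirection (barycentre τ)
        (inj₁ ∘ σ>0) (towards B.Λ (barycentre τ) τ-cases λ j _ → barycentre>0 τ B j)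
      decide σ-cases τ-cases (inj₁ _) (inj₂ τ>0) = λ _ → noCommonDirection (barycentre σ)
        (towards A.Λ (barycentre σ) σ-cases λ i _ → barycentre>0 σ A i) (inj₁ ∘ τ>0)
      decide σ-cases τ-cases (inj₁ (i , i≈0)) (inj₁ (j , j≈0)) = compare0 a >>= λ
        { (inj₁ a<0)        → pure (i , j , a , a<0 , proportional)
        ; (inj₂ (inj₁ a≈0)) → contradiction
            (trans (sym (zeroˡ ⟨ B.Λ j , f ⟩)) (trans (*-congʳ (sym a≈0)) (trans (sym (proportional f)) (A.dual-refl i)))) 0≉1
        ; (inj₂ (inj₂ a>0)) → λ _ → noCommonDirection e (towards A.Λ e σ-cases (σe>0 a>0)) (towards B.Λ e τ-cases τe>0) }
        where
        -- At this vertex `B.Λ j` takes the value 1, so `a` is the proportionality factor.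
        e = homogeneousVertices τ j
        f = homogeneousVertices σ i
        a = ⟨ A.Λ i , e ⟩
        proportional : ∀ X → ⟨ A.Λ i , X ⟩ ≈ a * ⟨ B.Λ j , X ⟩
        proportional = vanishing⇒proportional {Q = Q} Q-independent (A.Λ i) (B.Λ j) e
          (centre-vanish (A.Λ i) (σ≥0 i) i≈0) (centre-vanish (B.Λ j) (τ≥0 j) j≈0) (B.dual-refl j)
        -- By `uniqueFacet` no coordinate other than `i` vanishes at the centre, which leaves only
        -- the sign of `a` to be used.
        σe>0 : 0# < a → ∀ i′ → ⟨ A.Λ i′ , centre ⟩ ≈ 0# → 0# < ⟨ A.Λ i′ , e ⟩
        σe>0 a>0 i′ i′≈0 with i Fin.≟ i′
        ... | yes ≡.refl = a>0
        ... | no i≢i′ = contradiction (centre-vanish (A.Λ i′) (σ≥0 i′) i′≈0)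
          (uniqueFacet A i≢i′ (centre-vanish (A.Λ i) (σ≥0 i) i≈0))
        τe>0 : ∀ j′ → ⟨ B.Λ j′ , centre ⟩ ≈ 0# → 0# < ⟨ B.Λ j′ , e ⟩
        τe>0 j′ j′≈0 with j Fin.≟ j′
        ... | yes ≡.refl = <-respʳ (sym (B.dual-refl j)) 0<1
        ... | no j≢j′ = contradiction (centre-vanish (B.Λ j′) (τ≥0 j′) j′≈0)
          (uniqueFacet B j≢j′ (centre-vanish (B.Λ j) (τ≥0 j) j≈0))

  -- Generic directions

  signed : ∀ {n} → Bool → Vector Carrier n → Vector Carrier n
  signed false ℓ = ℓ
  signed true  ℓ = λ k → - ℓ k

  ⟨,⟩-neg : ∀ {n} (ℓ X : Vector Carrier n) → ⟨ signed true ℓ , X ⟩ ≈ - ⟨ ℓ , X ⟩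
  ⟨,⟩-neg ℓ X = begin
    sum (λ k → X k * - ℓ k)             ≈⟨ sum-cong-≋ (λ k → trans (sym (-‿distribʳ-* (X k) (ℓ k))) (sym (-1*x≈-x _))) ⟩
    sum (λ k → (- 1#) * (X k * ℓ k))    ≈⟨ *-distribˡ-sum (- 1#) (λ k → X k * ℓ k) ⟨
    (- 1#) * ⟨ ℓ , X ⟩                  ≈⟨ -1*x≈-x _ ⟩
    - ⟨ ℓ , X ⟩                         ∎

  HasSign⇒signed>0 : ∀ {n} b (ℓ X : Vector Carrier n) → HasSign b ⟨ ℓ , X ⟩ → 0# < ⟨ signed b ℓ , X ⟩
  HasSign⇒signed>0 false ℓ X p = p
  HasSign⇒signed>0 true  ℓ X p = <-respʳ (sym (⟨,⟩-neg ℓ X)) (neg⇒pos p)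

  signed>0⇒HasSign : ∀ {n} b (ℓ X : Vector Carrier n) → 0# < ⟨ signed b ℓ , X ⟩ → HasSign b ⟨ ℓ , X ⟩
  signed>0⇒HasSign false ℓ X p = p
  signed>0⇒HasSign true  ℓ X p = pos⇒neg (<-respʳ (⟨,⟩-neg ℓ X) p)

  -- Vectors with first entry zero are the directions of the affine space, its points at infinity.
  NonzeroOnDirections : ∀ {n} → Vector Carrier (suc n) → Set (c ⊔ ℓ₁ ⊔ ℓ₂)
  NonzeroOnDirections {n} ℓ = Σ[ e ∈ Vector Carrier (suc n) ] (e zero ≈ 0# × ⟨ ℓ , e ⟩ # 0#)

  -- If `ℓ` vanishes at `u`, then K `u` + `e` is used instead: `ℓ` takes there its value at `e`, and
  -- a large K preserves the strict inequalities.
  perturb : ∀ {m n} (g : Fin m → Vector Carrier (suc n)) ℓ → NonzeroOnDirections ℓ →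
    ∀ u → u zero ≈ 0# → (∀ a → 0# < ⟨ g a , u ⟩) →
    ¬ ¬ (Σ[ u′ ∈ Vector Carrier (suc n) ] (u′ zero ≈ 0# × (∀ a → 0# < ⟨ g a , u′ ⟩) × ⟨ ℓ , u′ ⟩ # 0#))
  perturb {n = n} g ℓ (e , e₀≈0 , ℓe#0) u u₀≈0 gu>0 = ¬¬-excluded-middle {A = ⟨ ℓ , u ⟩ # 0#} >>= λ
    { (yes ℓu#0) → pure (u , u₀≈0 , gu>0 , ℓu#0)
    ; (no ¬ℓu#0) → pure (u′ , u′₀≈0 , proj₂ (proj₂ large) , #-congʳ (sym (ℓu′≈ℓe (proj₁ (tight _ _) ¬ℓu#0))) ℓe#0) }
    where
    large : Σ[ K ∈ Carrier ] (0# < K × (∀ a → 0# < ⟨ g a , (λ k → K * u k + e k) ⟩))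
    large = eventually⇒∃ (eventually-all λ a → eventually-positive-linear (g a) u e (gu>0 a))
    K = proj₁ large
    u′ : Vector Carrier (suc n)
    u′ k = K * u k + e k
    u′₀≈0 : u′ zero ≈ 0#
    u′₀≈0 = trans (+-cong (trans (*-congˡ u₀≈0) (zeroʳ K)) e₀≈0) (+-identityˡ 0#)
    ℓu′≈ℓe : ⟨ ℓ , u ⟩ ≈ 0# → ⟨ ℓ , u′ ⟩ ≈ ⟨ ℓ , e ⟩
    ℓu′≈ℓe ℓu≈0 = trans (⟨,⟩-linear ℓ K u e)
      (trans (+-congʳ (trans (*-congˡ ℓu≈0) (zeroʳ K))) (+-identityˡ ⟨ ℓ , e ⟩))

  -- Once the first functional is nonzero, its sign joins the strict conditions `g`, so later
  -- perturbations cannot destroy it.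
  genericDirection : ∀ {l m n} (h : Fin l → Vector Carrier (suc n)) → (∀ b → NonzeroOnDirections (h b)) →
    (g : Fin m → Vector Carrier (suc n)) → ∀ u → u zero ≈ 0# → (∀ a → 0# < ⟨ g a , u ⟩) →
    ¬ ¬ (Σ[ u′ ∈ Vector Carrier (suc n) ]
      (u′ zero ≈ 0# × (∀ a → 0# < ⟨ g a , u′ ⟩) × (∀ b → ⟨ h b , u′ ⟩ # 0#)))
  genericDirection {zero}  h h≢0 g u u₀≈0 gu>0 = pure (u , u₀≈0 , gu>0 , λ ())
  genericDirection {suc l} h h≢0 g u u₀≈0 gu>0 = do
    u₁ , u₁₀≈0 , gu₁>0 , hu₁#0 ← perturb g (h zero) (h≢0 zero) u u₀≈0 gu>0
    let b , hu₁ = #0⇒HasSign hu₁#0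
    u₂ , u₂₀≈0 , gu₂>0 , hu₂#0 ← genericDirection (h ∘ suc) (h≢0 ∘ suc) (signed b (h zero) Vector.∷ g) u₁ u₁₀≈0
      λ { zero → HasSign⇒signed>0 b (h zero) u₁ hu₁ ; (suc a) → gu₁>0 a }
    pure (u₂ , u₂₀≈0 , gu₂>0 ∘ suc , λ
      { zero    → HasSign⇒#0 b (signed>0⇒HasSign b (h zero) u₂ (gu₂>0 zero))
      ; (suc a) → hu₂#0 a })

  sum≈0⊎>0 : ∀ {n} (f : Vector Carrier n) → (∀ i → f i ≈ 0# ⊎ 0# < f i) → sum f ≈ 0# ⊎ 0# < sum f
  sum≈0⊎>0 {zero}  f f≥0 = inj₁ refl
  sum≈0⊎>0 {suc n} f f≥0 with f≥0 zero | sum≈0⊎>0 (f ∘ suc) (f≥0 ∘ suc)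
  ... | inj₁ p | inj₁ q = inj₁ (trans (+-cong p q) (+-identityˡ 0#))
  ... | inj₁ p | inj₂ q = inj₂ (<-respʳ (sym (trans (+-congʳ p) (+-identityˡ _))) q)
  ... | inj₂ p | inj₁ q = inj₂ (<-respʳ (sym (trans (+-congˡ q) (+-identityʳ _))) p)
  ... | inj₂ p | inj₂ q = inj₂ (pos-+ p q)

  sum-pos-at : ∀ {n} (f : Vector Carrier n) → (∀ i → f i ≈ 0# ⊎ 0# < f i) → ∀ i → 0# < f i → 0# < sum f
  sum-pos-at f f≥0 zero    p with sum≈0⊎>0 (f ∘ suc) (f≥0 ∘ suc)
  ... | inj₁ q = <-respʳ (sym (trans (+-congˡ q) (+-identityʳ _))) p
  ... | inj₂ q = pos-+ p q
  sum-pos-at f f≥0 (suc i) p with f≥0 zero | sum-pos-at (f ∘ suc) (f≥0 ∘ suc) i p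
  ... | inj₁ q | r = <-respʳ (sym (trans (+-congʳ q) (+-identityˡ _))) r
  ... | inj₂ q | r = pos-+ q r

  ⟦_⟧ᵇ : Bool → Carrier
  ⟦ false ⟧ᵇ = 0#
  ⟦ true  ⟧ᵇ = 1#

  mixedDirection : ∀ {d} {σ : Simplex d} (B : Barycentric σ) (s : Fin (suc d) → Bool) →
    ∀ {i j} → s i ≡ true → s j ≡ false →
    Σ[ u ∈ Vector Carrier (suc d) ] (u zero ≈ 0# × (∀ k → HasSign (s k) ⟨ DualBasis.Λ B k , u ⟩))
  mixedDirection {d} {σ} B s {i} {j} si≡true sj≡false =
    combination b (homogeneousVertices σ) ,
    trans (sum-*1 b) sum-b ,
    λ k → HasSign-resp (s k) (sym (DualBasis.coordinate B k b)) (b-sign k)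
    where
    minus plus : Carrier
    minus = sum (λ k → ⟦ s k ⟧ᵇ)
    plus  = sum (λ k → ⟦ not (s k) ⟧ᵇ)

    ⟦⟧ᵇ≥0 : ∀ b → ⟦ b ⟧ᵇ ≈ 0# ⊎ 0# < ⟦ b ⟧ᵇ
    ⟦⟧ᵇ≥0 false = inj₁ refl
    ⟦⟧ᵇ≥0 true  = inj₂ 0<1

    minus>0 : 0# < minus
    minus>0 = sum-pos-at _ (λ k → ⟦⟧ᵇ≥0 (s k)) i (≡.subst (λ b → 0# < ⟦ b ⟧ᵇ) (≡.sym si≡true) 0<1)
    plus>0 : 0# < plus
    plus>0 = sum-pos-at _ (λ k → ⟦⟧ᵇ≥0 (not (s k))) j (≡.subst (λ b → 0# < ⟦ not b ⟧ᵇ) (≡.sym sj≡false) 0<1)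

    -- Each positive place receives the number of negative places, and each negative place minus the
    -- number of positive ones, so the total is zero. Mixed signs make both numbers positive.
    b : Vector Carrier (suc d)
    b k = ⟦ not (s k) ⟧ᵇ * minus + ⟦ s k ⟧ᵇ * - plus

    b-sign : ∀ k → HasSign (s k) (b k)
    b-sign k with s k
    ... | false = <-respʳ (sym (trans (+-cong (*-identityˡ minus) (zeroˡ (- plus))) (+-identityʳ minus))) minus>0
    ... | true  = <-respˡ (sym (trans (+-cong (zeroˡ minus) (*-identityˡ (- plus))) (+-identityˡ (- plus))))
      (pos⇒neg (<-respʳ (sym (-‿involutive plus)) plus>0))

    sum-b : sum b ≈ 0#
    sum-b = begin
      sum b
        ≈⟨ ∑-distrib-+ (λ k → ⟦ not (s k) ⟧ᵇ * minus) (λ k → ⟦ s k ⟧ᵇ * - plus) ⟩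
      sum (λ k → ⟦ not (s k) ⟧ᵇ * minus) + sum (λ k → ⟦ s k ⟧ᵇ * - plus)
        ≈⟨ +-cong (*-distribʳ-sum minus (λ k → ⟦ not (s k) ⟧ᵇ)) (*-distribʳ-sum (- plus) (λ k → ⟦ s k ⟧ᵇ)) ⟨
      plus * minus + minus * - plus
        ≈⟨ +-cong (*-comm plus minus) (sym (-‿distribʳ-* minus plus)) ⟩
      minus * plus + - (minus * plus)
        ≈⟨ -‿inverseʳ (minus * plus) ⟩
      0# ∎

  -- Proportional functionals

  module _ {n : ℕ} where

    Parallel : Vector Carrier n → Vector Carrier n → Set (c ⊔ ℓ₁ ⊔ ℓ₂)
    Parallel ℓ ℓ′ = ∃[ b ] Proportional b ℓ ℓ′

    Proportional-refl : ∀ {ℓ : Vector Carrier n} → Proportional false ℓ ℓ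
    Proportional-refl {ℓ} = 1# , 0<1 , λ X → sym (*-identityˡ ⟨ ℓ , X ⟩)

    Proportional-sym : ∀ b {ℓ ℓ′ : Vector Carrier n} → Proportional b ℓ ℓ′ → Proportional b ℓ′ ℓ
    Proportional-sym b {ℓ} {ℓ′} (a , sign , eq) = v , HasSign-inverse b (trans (*-comm a v) va≈1) sign , λ X → begin
      ⟨ ℓ′ , X ⟩             ≈⟨ *-identityˡ _ ⟨
      1# * ⟨ ℓ′ , X ⟩        ≈⟨ *-congʳ va≈1 ⟨
      v * a * ⟨ ℓ′ , X ⟩     ≈⟨ *-assoc v a _ ⟩
      v * (a * ⟨ ℓ′ , X ⟩)   ≈⟨ *-congˡ (eq X) ⟨
      v * ⟨ ℓ , X ⟩          ∎
      where
      v = proj₁ (inverse (HasSign⇒#0 b sign))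
      va≈1 = proj₂ (inverse (HasSign⇒#0 b sign))

    Proportional-trans : ∀ b b′ {ℓ ℓ′ ℓ″ : Vector Carrier n} →
      Proportional b ℓ ℓ′ → Proportional b′ ℓ′ ℓ″ → Proportional (b xor b′) ℓ ℓ″
    Proportional-trans b b′ {ℓ″ = ℓ″} (a , sign , eq) (a′ , sign′ , eq′) = a * a′ , HasSign-* b b′ sign sign′ ,
      λ X → trans (eq X) (trans (*-congˡ (eq′ X)) (sym (*-assoc a a′ ⟨ ℓ″ , X ⟩)))

    Proportional-unique : ∀ b b′ {ℓ ℓ′ : Vector Carrier n} e → ⟨ ℓ , e ⟩ ≈ 1# →
      Proportional b ℓ ℓ′ → Proportional b′ ℓ ℓ′ → b ≡ b′
    Proportional-unique b b′ e ℓe≈1 (a , sign , eq) (a′ , sign′ , eq′) = HasSign-unique b b′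
      (HasSign-inverse b (trans (sym (eq e)) ℓe≈1) sign) (HasSign-inverse b′ (trans (sym (eq′ e)) ℓe≈1) sign′)

    Parallel-refl : ∀ {ℓ : Vector Carrier n} → Parallel ℓ ℓ
    Parallel-refl {ℓ} = false , Proportional-refl {ℓ}

    Parallel-sym : ∀ {ℓ ℓ′ : Vector Carrier n} → Parallel ℓ ℓ′ → Parallel ℓ′ ℓ
    Parallel-sym {ℓ} {ℓ′} (b , p) = b , Proportional-sym b {ℓ} {ℓ′} p

    Parallel-trans : ∀ {ℓ ℓ′ ℓ″ : Vector Carrier n} → Parallel ℓ ℓ′ → Parallel ℓ′ ℓ″ → Parallel ℓ ℓ″
    Parallel-trans {ℓ} {ℓ′} {ℓ″} (b , p) (b′ , p′) = b xor b′ , Proportional-trans b b′ {ℓ} {ℓ′} {ℓ″} p p′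

  dualBasis-nonparallel : ∀ {n} {P : Fin n → Vector Carrier n} (B : DualBasis P) {i j} →
    Parallel (DualBasis.Λ B i) (DualBasis.Λ B j) → i ≡ j
  dualBasis-nonparallel {P = P} B {i} {j} (b , a , sign , eq) with j Fin.≟ i
  ... | yes j≡i = ≡.sym j≡i
  ... | no  j≢i = contradiction (begin
    0#                 ≈⟨ zeroʳ a ⟨
    a * 0#             ≈⟨ *-congˡ (dual-≢ j≢i) ⟨
    a * ⟨ Λ j , P i ⟩  ≈⟨ eq (P i) ⟨
    ⟨ Λ i , P i ⟩      ≈⟨ dual-refl i ⟩
    1#                 ∎) 0≉1
    where open DualBasis B

  -- Along the edge from another vertex to vertex `i` the coordinate `i` grows by 1. The other
  -- vertex exists because the dimension is positive.
  barycentric-nonzero : ∀ {d} {σ : Simplex (suc d)} (B : Barycentric σ) i → NonzeroOnDirections (DualBasis.Λ B i)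
  barycentric-nonzero {d} {σ} B i = (λ k → - 1# * P j k + P i k) ,
    trans (+-congʳ (trans (-1*x≈-x 1#) refl)) (-‿inverseˡ 1#) ,
    #-congʳ (sym (begin
      ⟨ Λ i , (λ k → - 1# * P j k + P i k) ⟩  ≈⟨ ⟨,⟩-linear (Λ i) (- 1#) (P j) (P i) ⟩
      - 1# * ⟨ Λ i , P j ⟩ + ⟨ Λ i , P i ⟩    ≈⟨ +-cong (trans (*-congˡ (dual-≢ (Fin.punchInᵢ≢i i zero ∘ ≡.sym))) (zeroʳ (- 1#))) (dual-refl i) ⟩
      0# + 1#                                 ≈⟨ +-identityˡ 1# ⟩
      1#                                      ∎)) 1#0
    where
    open DualBasis B
    P = homogeneousVertices σ
    j = punchIn i zero

  -- Encoding a neighborly family by clashing words.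

  module Labels {k n′ : ℕ} (F : Fin (suc n′) → Simplex (suc k)) (B : ∀ σ → Barycentric (F σ))
    (opposite : ∀ {σ τ} → σ ≢ τ →
      ∃[ i ] ∃[ j ] Proportional true (DualBasis.Λ (B σ) i) (DualBasis.Λ (B τ) j)) where

    dim : ℕ
    dim = suc (suc k)

    facet : Fin (suc n′) → Fin dim → Vector Carrier dim
    facet σ = DualBasis.Λ (B σ)

    -- The facets of all the simplices in one list, in which those of simplex zero come first.
    functional : Fin (suc n′ ℕ.* dim) → Vector Carrier dim
    functional a = uncurry facet (remQuot dim a)

    functional-combine : ∀ σ i → functional (combine σ i) ≡ facet σ i
    functional-combine σ i = ≡.cong (uncurry facet) (Fin.remQuot-combine σ i)

    facet-normalized : ∀ σ i → ⟨ facet σ i , homogeneousVertices (F σ) i ⟩ ≈ 1#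
    facet-normalized σ = DualBasis.dual-refl (B σ)

    -- The coordinates of the cube are the functionals; each hyperplane is
    -- represented by the first functional defining it.
    module Represent (parallel? : ∀ a b → Dec (Parallel (functional a) (functional b))) where

      private
        leastParallel : ∀ a → ∃[ b ] (Parallel (functional a) (functional b) ×
          (∀ c → Parallel (functional a) (functional c) → b Fin.≤ c))
        leastParallel a = least (parallel? a) (a , Parallel-refl {ℓ = functional a})

      representative : Fin (suc n′ ℕ.* dim) → Fin (suc n′ ℕ.* dim)
      representative a = proj₁ (leastParallel a)

      representative-parallel : ∀ a → Parallel (functional a) (functional (representative a))
      representative-parallel a = proj₁ (proj₂ (leastParallel a))

      representative-minimal : ∀ a b → Parallel (functional a) (functional b) → representative a Fin.≤ b
      representative-minimal a = proj₂ (proj₂ (leastParallel a))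

      representative-cong : ∀ a b → Parallel (functional a) (functional b) → representative a ≡ representative b
      representative-cong a b a∥b = Fin.≤-antisym
        (representative-minimal a _ (Parallel-trans {ℓ = functional a} {functional b} {functional (representative b)}
          a∥b (representative-parallel b)))
        (representative-minimal b _ (Parallel-trans {ℓ = functional b} {functional a} {functional (representative a)}
          (Parallel-sym {ℓ = functional a} {functional b} a∥b) (representative-parallel a)))

      label : Fin (suc n′) → Fin dim → Fin (suc n′ ℕ.* dim)
      label σ i = representative (combine σ i)

      private
        facet∥label : ∀ σ i → Parallel (facet σ i) (functional (label σ i))
        facet∥label σ i = ≡.subst (λ ℓ → Parallel ℓ (functional (label σ i))) (functional-combine σ i)
          (representative-parallel (combine σ i))

      orientation : Fin (suc n′) → Fin dim → Bool
      orientation σ i = proj₁ (facet∥label σ i)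

      facet-label : ∀ σ i → Proportional (orientation σ i) (facet σ i) (functional (label σ i))
      facet-label σ i = proj₂ (facet∥label σ i)

      label-cong : ∀ σ i τ j → Parallel (facet σ i) (facet τ j) → label σ i ≡ label τ j
      label-cong σ i τ j p = representative-cong (combine σ i) (combine τ j)
        (≡.subst₂ Parallel (≡.sym (functional-combine σ i)) (≡.sym (functional-combine τ j)) p)

      label-injective : ∀ σ {i j} → label σ i ≡ label σ j → i ≡ j
      label-injective σ {i} {j} eq = dualBasis-nonparallel (B σ)
        (Parallel-trans {ℓ = facet σ i} {functional (label σ i)} {facet σ j} (facet∥label σ i)
          (Parallel-sym {ℓ = facet σ j} {functional (label σ i)}
            (≡.subst (λ a → Parallel (facet σ j) (functional a)) (≡.sym eq) (facet∥label σ j))))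

      -- Representatives are least, so the label of a facet of simplex zero stays in the first
      -- block, where no two functionals are parallel.
      label-zero : ∀ i → label zero i ≡ i ↑ˡ (n′ ℕ.* dim)
      label-zero i with splitAt dim (label zero i) in eq
      ... | inj₁ i′ = ≡.trans (≡.sym i′↑≡) (≡.cong (_↑ˡ (n′ ℕ.* dim)) (≡.sym i≡i′))
        where
        i′↑≡ : i′ ↑ˡ (n′ ℕ.* dim) ≡ label zero i
        i′↑≡ = Fin.splitAt⁻¹-↑ˡ eq
        i≡i′ : i ≡ i′
        i≡i′ = dualBasis-nonparallel (B zero) (≡.subst (Parallel (facet zero i))
          (≡.trans (≡.cong functional (≡.sym i′↑≡)) (functional-combine zero i′)) (facet∥label zero i))
      ... | inj₂ b = contradiction
        (≡.subst (Fin._≤ (i ↑ˡ (n′ ℕ.* dim))) (≡.sym (Fin.splitAt⁻¹-↑ʳ eq))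
          (representative-minimal (combine {suc n′} zero i) (i ↑ˡ (n′ ℕ.* dim))
            (Parallel-refl {ℓ = functional (combine {suc n′} zero i)})))
        (ℕ.<⇒≱ (≡.subst₂ ℕ._<_ (≡.sym (Fin.toℕ-↑ˡ i (n′ ℕ.* dim))) (≡.sym (Fin.toℕ-↑ʳ dim b))
          (ℕ.≤-trans (Fin.toℕ<n i) (ℕ.m≤m+n dim (toℕ b)))))

      -- By `label-zero` these facets represent themselves, and the factor 1 fixes the sign.
      orientation-zero : ∀ i → orientation zero i ≡ false
      orientation-zero i = Proportional-unique (orientation zero i) false {facet zero i} {functional (label zero i)}
        (homogeneousVertices (F zero) i) (facet-normalized zero i) (facet-label zero i)
        (≡.subst (Proportional false (facet zero i))
          (≡.sym (≡.trans (≡.cong functional (label-zero i)) (functional-combine zero i)))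
          (Proportional-refl {ℓ = facet zero i}))

      -- Simplex zero is given the prefix word outright, in the form that `coveredFibre` expects;
      -- `lookup-word` shows that it obeys the same rule as the others.
      word : Fin (suc n′) → Word (dim ℕ.+ n′ ℕ.* dim)
      word zero    = prefixWord dim (n′ ℕ.* dim)
      word (suc σ) = wordOf (label (suc σ)) (orientation (suc σ))

      lookup-word : ∀ σ i → lookup (word σ) (label σ i) ≡ just (orientation σ i)
      lookup-word zero    i = ≡.trans (≡.cong (lookup (word zero)) (label-zero i))
        (≡.trans (lookup-prefixWord dim (n′ ℕ.* dim) i) (≡.cong just (≡.sym (orientation-zero i))))
      lookup-word (suc σ) i = lookup-wordOf (label (suc σ)) (orientation (suc σ)) (label-injective (suc σ)) i

      -- The opposite facets share a label, and the negative factor between them reverses the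
      -- orientation.
      word-clash : ∀ {σ τ} → σ ≢ τ → Clash (word σ) (word τ)
      word-clash {σ} {τ} σ≢τ = label σ i , orientation σ i , lookup-word σ i ,
        ≡.trans (≡.cong (lookup (word τ)) label≡)
          (≡.trans (lookup-word τ j) (≡.cong just (≡.trans (≡.sym (Bool.not-involutive _)) (≡.cong not (≡.sym orientation≡)))))
        where
        i = proj₁ (opposite σ≢τ)
        j = proj₁ (proj₂ (opposite σ≢τ))
        p : Proportional true (facet σ i) (facet τ j)
        p = proj₂ (proj₂ (opposite σ≢τ))
        label≡ : label σ i ≡ label τ j
        label≡ = label-cong σ i τ j (true , p)
        orientation≡ : orientation σ i ≡ not (orientation τ j)
        orientation≡ = Proportional-unique (orientation σ i) (true xor orientation τ j) {facet σ i} {functional (label σ i)}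
          (homogeneousVertices (F σ) i) (facet-normalized σ i) (facet-label σ i)
          (Proportional-trans true (orientation τ j) {facet σ i} {facet τ j} {functional (label σ i)} p
            (≡.subst (λ a → Proportional (orientation τ j) (facet τ j) (functional a)) (≡.sym label≡) (facet-label τ j)))

      -- A generic direction is uncovered: the barycentric coordinates of a
      -- direction sum to zero, so for every simplex one of them is negative.
      uncovered : ∀ (s : Vec Bool dim) → ∃[ i ] lookup s i ≡ true → ∃[ j ] lookup s j ≡ false →
        ¬ ¬ (Σ[ t ∈ Vec Bool (n′ ℕ.* dim) ] (∀ σ → weight (word (suc σ)) (s ++ t) ≡ ℤ.0ℤ))
      uncovered s (i , sᵢ) (j , sⱼ) = do
        -- `u` has the signs `s` on simplex zero. These enter the perturbation as strict
        -- inequalities, so `v` keeps them while leaving every facet hyperplane.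
        let u , u₀≈0 , s-sign = mixedDirection {σ = F zero} (B zero) (lookup s) sᵢ sⱼ
        v , v₀≈0 , s-sign′ , generic ← genericDirection functional
          (λ a → barycentric-nonzero {σ = F (proj₁ (remQuot dim a))} (B (proj₁ (remQuot dim a))) (proj₂ (remQuot {suc n′} dim a)))
          (λ a → signed (lookup s a) (facet zero a)) u u₀≈0
          (λ a → HasSign⇒signed>0 (lookup s a) (facet zero a) u (s-sign a))
        pure (coveredBy v v₀≈0 (λ a → signed>0⇒HasSign (lookup s a) (facet zero a) v (s-sign′ a)) generic)
        where
        coveredBy : ∀ v → v zero ≈ 0# → (∀ a → HasSign (lookup s a) ⟨ facet zero a , v ⟩) →
          (∀ a → ⟨ functional a , v ⟩ # 0#) →
          Σ[ t ∈ Vec Bool (n′ ℕ.* dim) ] (∀ σ → weight (word (suc σ)) (s ++ t) ≡ ℤ.0ℤ)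
        coveredBy v v₀≈0 s-sign generic = t , λ σ →
          let i , facet<0 = negative (suc σ)
          in weight-mismatch (word (suc σ)) (s ++ t) (label (suc σ) i) (lookup-word (suc σ) i) (mismatch (suc σ) i facet<0)
          where
          t : Vec Bool (n′ ℕ.* dim)
          t = tabulate λ b → proj₁ (#0⇒HasSign (generic (dim ↑ʳ b)))

          sign-at : ∀ a x → splitAt dim a ≡ x → HasSign (lookup (s ++ t) a) ⟨ functional a , v ⟩
          sign-at a (inj₁ i) eq = ≡.subst (λ a → HasSign (lookup (s ++ t) a) ⟨ functional a , v ⟩) (Fin.splitAt⁻¹-↑ˡ eq)
            (≡.subst₂ (λ b ℓ → HasSign b ⟨ ℓ , v ⟩) (≡.sym (Vec.lookup-++ˡ s t i)) (≡.sym (functional-combine zero i)) (s-sign i))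
          sign-at a (inj₂ b) eq = ≡.subst (λ a → HasSign (lookup (s ++ t) a) ⟨ functional a , v ⟩) (Fin.splitAt⁻¹-↑ʳ eq)
            (≡.subst (λ c → HasSign c ⟨ functional (dim ↑ʳ b) , v ⟩)
              (≡.sym (≡.trans (Vec.lookup-++ʳ s t b) (Vec.lookup∘tabulate _ b)))
              (proj₂ (#0⇒HasSign (generic (dim ↑ʳ b)))))

          sign-vector : ∀ a → HasSign (lookup (s ++ t) a) ⟨ functional a , v ⟩
          sign-vector a = sign-at a (splitAt dim a) ≡.refl

          negative : ∀ σ → ∃[ i ] ⟨ facet σ i , v ⟩ < 0#
          negative σ with search (λ i → #0⇒<⊎> (≡.subst (λ ℓ → ⟨ ℓ , v ⟩ # 0#) (functional-combine σ i) (generic (combine σ i))))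
          ... | inj₁ p  = p
          ... | inj₂ >0 = contradiction
            (>0⇒#0 (<-respʳ (trans (sum-coordinates (F σ) (B σ) v) v₀≈0) (sum-pos (λ i → ⟨ facet σ i , v ⟩) >0)))
            (#-irrefl refl)

          -- The word of σ prescribes the signs for which all its coordinates are positive; a
          -- negative coordinate therefore violates one of its letters.
          mismatch : ∀ σ i → ⟨ facet σ i , v ⟩ < 0# → lookup (s ++ t) (label σ i) ≡ not (orientation σ i)
          mismatch σ i facet<0 = xor-true (orientation σ i) _ (HasSign-unique
            (orientation σ i xor lookup (s ++ t) (label σ i)) true
            (HasSign-* (orientation σ i) (lookup (s ++ t) (label σ i)) (proj₁ (proj₂ (facet-label σ i))) (sign-vector (label σ i)))
            (<-respˡ (proj₂ (proj₂ (facet-label σ i)) v) facet<0))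
            where
            xor-true : ∀ a b → a xor b ≡ true → b ≡ not a
            xor-true false true  _ = ≡.refl
            xor-true true  false _ = ≡.refl

      -- `coveredFibre` would give a sign vector `s` of mixed signs whose whole fibre is covered,
      -- whereas `uncovered` finds a point of that fibre missed by all the words.
      tooManySimplices : ¬ (2 ^ dim ≤ k ℕ.+ suc n′)
      tooManySimplices large =
        let s , s-nonzero , s≢antipode , covered = coveredFibre k (ℕ.+-comm k 2) words clashes widths
              (≡.subst (λ l → 2 ^ dim ≤ k ℕ.+ suc l) (≡.sym (List.length-tabulate (word ∘ suc))) large)
        in uncovered s (Nonzero⇒∃true s-nonzero) (≢antipode⇒∃false s s≢antipode)
             λ { (t , zeros) → covered t (All.tabulate⁺ zeros) }
        where
        words = List.tabulate (word ∘ suc)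
        clashes = All.tabulate⁺ {f = word ∘ suc} (λ σ → word-clash {zero} {suc σ} (λ ()))
          ∷ AllPairs.tabulate⁺ {f = word ∘ suc} (λ σ≢τ → word-clash (σ≢τ ∘ Fin.suc-injective))
        widths = All.tabulate⁺ {f = word ∘ suc} (λ σ → width-wordOf (label (suc σ)) (orientation (suc σ)))

  -- With d = `suc k`, failure of the bound is a strict inequality and reads 2 ^ dim ≤ k + n. The
  -- unit gained by strictness keeps the codimension at `k`, two below `dim`.
  neighborly-bound : ∀ {k n} (F : Fin n → Simplex (suc k)) → IsNeighborlyFamily F → n ℕ.+ suc k ≤ 2 ^ suc (suc k)
  -- The empty family has no simplex to distinguish and is treated directly.
  neighborly-bound {k} {zero}   F family = ℕ.<⇒≤ (ℕ.<-trans (ℕ.n<1+n (suc k)) (n<2^n (suc (suc k))))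
    where
    n<2^n : ∀ n → n ℕ.< 2 ^ n
    n<2^n zero    = s≤s z≤n
    n<2^n (suc n) = ℕ.≤-trans (ℕ.+-mono-≤ (ℕ.m^n>0 2 n) (n<2^n n)) (ℕ.≤-reflexive (≡.cong (2 ^ n ℕ.+_) (≡.sym (ℕ.+-identityʳ (2 ^ n)))))
  neighborly-bound {k} {suc n′} F family = decidable-stable (_ ℕ.≤? _) λ n+d≰2^ → (do
    B ← ¬¬-all λ σ → barycentric (F σ)
    opposite ← ¬¬-all λ σ → ¬¬-all λ τ → oppositeIfDistinct B σ τ
    parallel? ← ¬¬-all λ a → ¬¬-all λ b → ¬¬-excluded-middle
    pure (Labels.Represent.tooManySimplices F B (λ {σ} {τ} → opposite σ τ) parallel? (large n+d≰2^))) (λ ())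
    where
    oppositeIfDistinct : ∀ B σ τ → ¬ ¬ (σ ≢ τ →
      ∃[ i ] ∃[ j ] Proportional true (DualBasis.Λ (B σ) i) (DualBasis.Λ (B τ) j))
    oppositeIfDistinct B σ τ with σ Fin.≟ τ
    ... | yes σ≡τ = pure λ σ≢τ → contradiction σ≡τ σ≢τ
    ... | no  σ≢τ = Contact.oppositeFacets {σ = F σ} {F τ} (B σ) (B τ) (IsNeighborlyFamily.neighborly family σ≢τ)
      >>= λ p → pure λ _ → p
    large : ¬ (suc n′ ℕ.+ suc k ≤ 2 ^ suc (suc k)) → 2 ^ suc (suc k) ≤ k ℕ.+ suc n′
    large n+d≰2^ = ℕ.≤-trans (ℕ.≤-pred (ℕ.≰⇒> n+d≰2^))
      (ℕ.≤-reflexive (≡.trans (ℕ.+-suc n′ k) (≡.trans (≡.cong suc (ℕ.+-comm n′ k)) (≡.sym (ℕ.+-suc k n′)))))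

-- The limit.

open import Data.Integer.Base using (+_; _-_)
open import Data.Nat.Base using (ℕ; suc; _≤_; _^_)

theorem1 : ∀ {c ℓ₁ ℓ₂} (R : RealNumbers c ℓ₁ ℓ₂) (S : ℕ → ℕ) →
    (∀ d → 1 ≤ d → Simplices.IsMaximalCardinality R d (S d)) →
    TendsToInfinity (λ d → + (2 ^ suc d) - + (S d))
theorem1 R S maximal K = suc ℤ.∣ K ∣ , λ { (suc k) (s≤s ∣K∣≤k) → bound k ∣K∣≤k }
  where
  -- The difference is at least d = `suc k`, hence at least K. The successor in the threshold
  -- excludes d = 0.
  bound : ∀ k → ℤ.∣ K ∣ ≤ k → K ℤ.≤ + (2 ^ suc (suc k)) - + S (suc k)
  bound k ∣K∣≤k =
    let F , family = Simplices.IsMaximalCardinality.attained (maximal (suc k) (s≤s z≤n))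
        n+d≤2^ = Geometry.neighborly-bound R F family
        -- This makes the truncated difference agree with the integer one.
        S≤2^ = ℕ.≤-trans (ℕ.m≤m+n (S (suc k)) (suc k)) n+d≤2^
    in ℤ.≤-trans (i≤+∣i∣ K) (ℤ.≤-trans (ℤ.+≤+ (ℕ.≤-trans (ℕ.m≤n⇒m≤1+n ∣K∣≤k) (ℕ.m+n≤o⇒m≤o∸n (suc k)
           (ℕ.≤-trans (ℕ.≤-reflexive (ℕ.+-comm (suc k) (S (suc k)))) n+d≤2^))))
         (ℤ.≤-reflexive (≡.sym (≡.trans (ℤ.m-n≡m⊖n (2 ^ suc (suc k)) (S (suc k))) (ℤ.⊖-≥ S≤2^)))))
    where
    i≤+∣i∣ : ∀ i → i ℤ.≤ + ℤ.∣ i ∣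
    i≤+∣i∣ (+ n)        = ℤ.≤-refl
    i≤+∣i∣ (ℤ.-[1+ n ]) = ℤ.-≤+
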